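{- The competitive factor of any online algorithm for the online power-minimizing scheduling problem is at least $2.06$; that is, if an online algorithm for this problem is $c$-competitive, then $c\ge 2.06$.
   Context: **Jobs.** A job $j$ is a triple $(a_j,d_j,c_j)$ of arrival time $a_j\ge 0$, deadline $d_j$ and execution time $c_j$, where $c_j$ and $d_j$ become known at time $a_j$. **Processors and energy.** A processor is at any time busy, standby, or off. Switching a processor from off to another state costs $E_w$ units of energy; a busy processor (executing a job) consumes $\psi_b$ units of energy per unit time; a standby processor (on, but not executing a job) consumes $\psi_\sigma$ per unit time, with $\psi_\sigma\le\psi_b$; an off processor consumes nothing and cannot execute jobs. **Schedules.** A schedule $\mathbf{S}$ of a job set $\mathcal{J}$ on a set $\mathcal{M}$ of processors consists, for each $m\in\mathcal{M}$, of a set $\mathcal{I}_m$ of (disjoint) time intervals during which $m$ is on and a function $\mathrm{job}_m:\mathbb{R}^+\to\mathcal{J}\cup\{\phi\}$ giving the job that occupies $m$ at time $t$ ($\phi$ meaning none). Preemption is allowed. With $\delta(x,y)=1$ if $x=y$ and $0$ otherwise, $\mathbf{S}$ is feasible if for every $j\in\mathcal{J}$ there is a processor $m\in\mathcal{M}$ with $\sum_{I\in\mathcal{I}_m}\int_{I\cap[a_j,d_j]}\delta(\mathrm{job}_m(t),j)\,dt\ge c_j$. Its energy is $$E(\mathbf{S})=\sum_{m\in\mathcal{M}}\Big(E_w|\mathcal{I}_m|+\sum_{I\in\mathcal{I}_m}\int_I\big(\psi_b-\delta(\mathrm{job}_m(t),\phi)(\psi_b-\psi_\sigma)\big)\,dt\Big).$$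 An optimal schedule is a feasible schedule of minimum energy; $OPT(\mathcal{J})$ denotes its energy. **Online problem.** Let $\mathcal{J}(t)=\{j\in\mathcal{J}: a_j\le t\}$. An online algorithm must make its decisions (on/off and job execution) at each time $t$ knowing only $\mathcal{J}(t)$, deterministically, and must produce a feasible schedule; it may use as many processors as it needs. It is $c$-competitive (has competitive factor $c$) if for all values of $E_w,\psi_b,\psi_\sigma$, every input job set $\mathcal{J}$ and every $t\ge 0$, the energy it consumes up to time $t$ is at most $c\cdot OPT(\mathcal{J}(t))$. -}

module Defs where

open import Algebra.Core using (Op₁; Op₂)
open import Algebra.Structures using (IsCommutativeRing)
import Algebra.Construct.NaturalChoice.Max as Max
import Algebra.Construct.NaturalChoice.Min as Min
open import Data.Bool.Base using (if_then_else_)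
open import Data.List.Base using (List; []; _∷_; filter; foldr; length; map; upTo)
open import Data.List.Membership.Propositional using (_∈_)
open import Data.List.Relation.Binary.BagAndSetEquality using (_∼[_]_; set)
open import Data.List.Relation.Unary.All using (All)
import Data.List.Relation.Unary.All.Properties as All
open import Data.List.Relation.Unary.AllPairs using (AllPairs)
open import Data.List.Relation.Unary.Any using (Any)
open import Data.List.Relation.Unary.Unique.Propositional using (Unique)
import Data.List.Relation.Unary.Unique.Propositional.Properties as Unique
open import Data.Maybe.Base using (Maybe; just; nothing)
import Data.Maybe.Properties as Maybe
open import Data.Nat.Base as ℕ using (ℕ; zero; suc)
open import Data.Product.Base using (Σ-syntax; ∃; ∃-syntax; _×_; _,_; proj₁; proj₂)
open import Function.Base using (_∘_)
open import Function.Bundles using (_⇔_)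
open import Relation.Binary.Bundles using (DecTotalOrder; TotalOrder)
open import Relation.Binary.Core using (Rel)
open import Relation.Binary.Definitions using (DecidableEquality)
open import Relation.Binary.PropositionalEquality.Core using (_≡_; _≢_; refl)
open import Relation.Binary.Structures using (IsDecTotalOrder)
import Relation.Binary.Construct.NonStrictToStrict as ToStrict
open import Relation.Nullary.Decidable using (does; map′; _×-dec_)
open import Relation.Nullary.Negation.Core using (¬_)
open import Level using (0ℓ)

-- The real numbers, given axiomatically as a Dedekind-complete ordered field.
-- Classically this determines ℝ up to isomorphism.  The order is decidable
-- because the mathematics is classical.  The value of 0# ⁻¹ is unspecified.
record Reals : Set₁ where
  infixl 6 _+_ _-_
  infixl 7 _*_
  infix  8 -_
  infix  9 _⁻¹
  infix  4 _≤_
  field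
    ℝ       : Set
    _+_ _*_ : Op₂ ℝ
    -_ _⁻¹  : Op₁ ℝ
    0# 1#   : ℝ
    _≤_     : Rel ℝ 0ℓ

    isCommutativeRing : IsCommutativeRing _≡_ _+_ _*_ -_ 0# 1#
    0≢1               : 0# ≢ 1#
    *-inverseʳ        : ∀ x → x ≢ 0# → x * x ⁻¹ ≡ 1#

    isDecTotalOrder   : IsDecTotalOrder _≡_ _≤_
    +-monoˡ-≤         : ∀ z {x y} → x ≤ y → x + z ≤ y + z
    *-nonNegative     : ∀ {x y} → 0# ≤ x → 0# ≤ y → 0# ≤ x * y

  UpperBound : (ℝ → Set) → ℝ → Set
  UpperBound P u = ∀ x → P x → x ≤ u

  field
    complete : (P : ℝ → Set) → ∃ P → ∃ (UpperBound P) →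
               ∃[ s ] UpperBound P s × (∀ u → UpperBound P u → s ≤ u)

  decTotalOrder : DecTotalOrder 0ℓ 0ℓ 0ℓ
  decTotalOrder = record { isDecTotalOrder = isDecTotalOrder }

  open DecTotalOrder decTotalOrder public
    using (_≟_; _≤?_; totalOrder)
    renaming (refl to ≤-refl; trans to ≤-trans)

  open ToStrict _≡_ _≤_ public using (<⇒≤) renaming (_<_ to infix 4 _<_)
  open Max totalOrder public using (_⊔_; maxOperator)
  open Min totalOrder public using (_⊓_; minOperator)

  import Algebra.Construct.NaturalChoice.MaxOp as MaxOp
  open MaxOp maxOperator public using (x≤x⊔y)

  _-_ : Op₂ ℝ
  x - y = x + (- y)

  fromℕ : ℕ → ℝ
  fromℕ zero    = 0#
  fromℕ (suc n) = 1# + fromℕ n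

  sum : List ℝ → ℝ
  sum = foldr _+_ 0#

-- The Henstock–Kurzweil integral.  On a compact interval, a bounded function
-- is integrable in this sense iff it is Lebesgue measurable, and the two
-- integrals then agree.
module Integration (R : Reals) where
  open Reals R

  data TaggedPartition : ℝ → ℝ → Set where
    []  : ∀ {a} → TaggedPartition a a
    add : ∀ {a b} (u tag : ℝ) → a ≤ tag → tag ≤ u →
          TaggedPartition u b → TaggedPartition a b

  data Fine (γ : ℝ → ℝ) : ∀ {a b} → TaggedPartition a b → Set where
    []  : ∀ {a} → Fine γ ([] {a})
    add : ∀ {a b u tag} {a≤tag : a ≤ tag} {tag≤u : tag ≤ u}
          {p : TaggedPartition u b} →
          u - a < γ tag → Fine γ p → Fine γ (add u tag a≤tag tag≤u p)

  riemannSum : (ℝ → ℝ) → ∀ {a b} → TaggedPartition a b → ℝ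
  riemannSum f []                    = 0#
  riemannSum f {a} (add u tag _ _ p) = f tag * (u - a) + riemannSum f p

  HasIntegral : (f : ℝ → ℝ) (a b v : ℝ) → Set
  HasIntegral f a b v =
    ∀ ε → 0# < ε →
    Σ[ γ ∈ (ℝ → ℝ) ] (∀ x → 0# < γ x) ×
      (∀ (p : TaggedPartition a b) → Fine γ p →
        (v - ε < riemannSum f p) × (riemannSum f p < v + ε))

  Integrable : (f : ℝ → ℝ) (a b : ℝ) → Set
  Integrable f a b = ∃[ v ] HasIntegral f a b v

  ∫ : ∀ {f a b} → Integrable f a b → ℝ
  ∫ = proj₁

module Scheduling (R : Reals) where
  open Reals R public
  open Integration R public

  record Job : Set where
    constructor job
    field
      arrival deadline exec : ℝ
  open Job public

  _≟ⱼ_ : DecidableEquality Job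
  job a d c ≟ⱼ job a′ d′ c′ =
    map′ (λ { (refl , refl , refl) → refl }) (λ { refl → refl , refl , refl })
         (a ≟ a′ ×-dec (d ≟ d′ ×-dec c ≟ c′))

  -- A job set can be scheduled feasibly only if each job fits between its
  -- arrival and its deadline; with one processor per job this also suffices.
  record WellFormed (j : Job) : Set where
    field
      arrival≥0 : 0# ≤ arrival j
      exec≥0    : 0# ≤ exec j
      fits      : arrival j + exec j ≤ deadline j

  record JobSet : Set where
    field
      jobs       : List Job
      unique     : Unique jobs
      wellFormed : All WellFormed jobs
  open JobSet public

  arrivedBy : ℝ → JobSet → JobSet
  arrivedBy t J = record
    { jobs       = filter arrived? (jobs J)
    ; unique     = Unique.filter⁺ arrived? (unique J)
    ; wellFormed = All.filter⁺ arrived? (wellFormed J)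
    }
    where arrived? = λ j → arrival j ≤? t

  record Parameters : Set where
    field
      E-w ψ-b ψ-σ : ℝ
      E-w>0       : 0# < E-w
      ψ-σ>0       : 0# < ψ-σ
      ψ-σ≤ψ-b     : ψ-σ ≤ ψ-b
  open Parameters public

  -- The half-open time interval [ start , stop ).
  record Interval : Set where
    field
      start stop : ℝ
      start≥0    : 0# ≤ start
      start<stop : start < stop
  open Interval public

  _∈ᵢ_ : ℝ → Interval → Set
  t ∈ᵢ I = start I ≤ t × t < stop I

  Disjoint : Interval → Interval → Set
  Disjoint I I′ = ∀ t → ¬ (t ∈ᵢ I × t ∈ᵢ I′)

  -- The set of processors is { 0 , … , size - 1 }; numbering processors by ℕ
  -- gives them identities across schedules of different sizes.  The value
  -- `nothing` of jobAt is the symbol φ.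
  record Schedule (J : JobSet) : Set where
    field
      size       : ℕ
      intervals  : ℕ → List Interval
      disjoint   : ∀ m → AllPairs Disjoint (intervals m)
      unused     : ∀ m → size ℕ.≤ m → intervals m ≡ []
      jobAt      : ℕ → ℝ → Maybe Job
      jobAt∈J    : ∀ m t {j} → jobAt m t ≡ just j → j ∈ jobs J
      -- Measurability of jobAt m, without which the integrals defining
      -- feasibility and energy make no sense.
      measurable : ∀ m (g : Maybe Job → ℝ) {a b} → 0# ≤ a → a ≤ b →
                   Integrable (g ∘ jobAt m) a b

    On : ℕ → ℝ → Set
    On m t = Any (t ∈ᵢ_) (intervals m)

    SwitchedOnAt : ℕ → ℝ → Set
    SwitchedOnAt m t = Any (λ I → start I ≡ t) (intervals m)

    ∫[_] : Interval → ℕ → (Maybe Job → ℝ) → ℝ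
    ∫[ I ] m g = ∫ (measurable m g (start≥0 I) (<⇒≤ (start<stop I)))

    -- The integral over I ∩ [ a , b ].  If this intersection is empty, then
    -- the two limits of integration below coincide.
    ∫[_∩[_,_]] : Interval → ℝ → ℝ → ℕ → (Maybe Job → ℝ) → ℝ
    ∫[ I ∩[ a , b ]] m g =
      ∫ (measurable m g {lo} {lo ⊔ (stop I ⊓ b)}
           (≤-trans (start≥0 I) (x≤x⊔y (start I) a))
           (x≤x⊔y lo (stop I ⊓ b)))
      where lo = start I ⊔ a
  open Schedule public

  δ : Maybe Job → Maybe Job → ℝ
  δ x y = if does (Maybe.≡-dec _≟ⱼ_ x y) then 1# else 0#

  Feasible : ∀ {J} → Schedule J → Set
  Feasible {J} S =
    ∀ j → j ∈ jobs J →
    ∃[ m ] (m ℕ.< size S) ×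
      (exec j ≤ sum (map (λ I → ∫[_∩[_,_]] S I (arrival j) (deadline j) m
                                  (λ x → δ x (just j)))
                         (intervals S m)))

  power : Parameters → Maybe Job → ℝ
  power p x = ψ-b p - δ x nothing * (ψ-b p - ψ-σ p)

  energy : Parameters → ∀ {J} → Schedule J → ℝ
  energy p S = sum (map energyOf (upTo (size S)))
    where
    energyOf : ℕ → ℝ
    energyOf m =
      E-w p * fromℕ (length (intervals S m)) +
      sum (map (λ I → ∫[_] S I m (power p)) (intervals S m))

  energyUpTo : Parameters → ℝ → ∀ {J} → Schedule J → ℝ
  energyUpTo p t S = sum (map energyOf (upTo (size S)))
    where
    energyOf : ℕ → ℝ
    energyOf m =
      E-w p * fromℕ (length (filter (λ I → start I ≤? t) (intervals S m))) +
      sum (map (λ I → ∫[_∩[_,_]] S I 0# t m (power p)) (intervals S m))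

  Optimal : Parameters → ∀ {J} → Schedule J → Set
  Optimal p {J} S =
    Feasible S × (∀ (S′ : Schedule J) → Feasible S′ → energy p S ≤ energy p S′)

  -- A processor that is off executes nothing, so the value of jobAt matters
  -- only while the processor is on.
  record SameDecisions (t : ℝ) {J J′} (S : Schedule J) (S′ : Schedule J′) : Set where
    field
      same-on     : ∀ m → On S m t ⇔ On S′ m t
      same-switch : ∀ m → SwitchedOnAt S m t ⇔ SwitchedOnAt S′ m t
      same-job    : ∀ m → On S m t → jobAt S m t ≡ jobAt S′ m t

  -- Online-ness: what is done at time t depends only on the set J(t).  Since
  -- J(t) determines J(s) for every s ≤ t, the whole history up to time t does.
  record OnlineAlgorithm : Set where
    field
      run      : Parameters → (J : JobSet) → Schedule J
      feasible : ∀ p J → Feasible (run p J)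
      online   : ∀ p J J′ t → 0# ≤ t →
                 jobs (arrivedBy t J) ∼[ set ] jobs (arrivedBy t J′) →
                 SameDecisions t (run p J) (run p J′)
  open OnlineAlgorithm public

  -- OPT(J(t)) is the energy of any optimal schedule of J(t).
  Competitive : OnlineAlgorithm → ℝ → Set
  Competitive A c =
    ∀ p J t → 0# ≤ t → (S : Schedule (arrivedBy t J)) → Optimal p S →
    energyUpTo p t (run A p J) ≤ c * energy p S

{-# OPTIONS --safe #-}
module Submission where

-- Take E-w = 100 and ψ-b = ψ-σ = 1, so that a schedule costs 100 per switch-on
-- plus its total on-time.  The first job is flexible: one unit of work, to be
-- done by time 51.  If the algorithm is off at time 0, a job filling all of
-- [1, 51) follows, and a second switch-on is unavoidable.  If it is on at time
-- 0, a job filling [50, 51) follows: either the algorithm was off at some point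
-- before 50 and has to switch on again, or it has been on since time 0.  The
-- optimum is a single stretch ending at 51.  From then on, each time the
-- algorithm switches off the adversary releases an urgent unit job one unit of
-- time later: the algorithm pays another switch-on, whereas the optimum merely
-- stays on.  While 206 · opt − 100 · spent = s, the algorithm can stay on for at
-- most s / 100, and the next such job turns s into at most 2.06 s − 9588; starting
-- from s ≤ 6112 this is negative after two jobs.

open import Defs

open import Algebra.Bundles using (CommutativeRing)
open import Algebra.Construct.NaturalChoice.Base using (MaxOperator)
import Algebra.Construct.NaturalChoice.MaxOp as MaxOp
import Algebra.Construct.NaturalChoice.MinOp as MinOp
import Algebra.Properties.Ring
import Algebra.Properties.Semiring.Mult
import Algebra.Solver.Ring
open import Algebra.Solver.Ring.AlmostCommutativeRing
  using (_-Raw-AlmostCommutative⟶_; fromCommutativeRing)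
open import Data.Bool.Base using (if_then_else_)
open import Data.Empty using (⊥)
open import Data.Integer.Base as ℤ using (ℤ; -[1+_]; +[1+_]; +0; _⊖_; _◃_)
import Data.Integer.Properties as ℤ
open import Data.List.Base using (List; []; _∷_; _++_; filter; length; map; upTo; concatMap)
open import Data.List.Membership.Propositional using (_∈_; find; lose)
open import Data.List.Membership.Propositional.Properties
  using (∈-filter⁺; ∈-filter⁻; ∈-concatMap⁺; ∈-concatMap⁻; ∈-map⁺; ∈-map⁻; ∈-upTo⁺)
open import Data.List.Properties using (map-++; map-∘)
open import Data.List.Relation.Unary.All as All using (All; []; _∷_)
open import Data.List.Relation.Unary.AllPairs using (AllPairs; []; _∷_)
open import Data.List.Relation.Unary.Any as Any using (Any; here; there; any?)
open import Data.Maybe.Base using (Maybe; just; nothing)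
import Data.Maybe.Properties as Maybe
open import Data.Nat.Base as ℕ using (ℕ; zero; suc)
import Data.Nat.Properties as ℕ
open import Data.Product.Base using (∃-syntax; Σ-syntax; _×_; _,_; proj₁; proj₂)
import Data.Sign.Base as Sign
open import Data.Sum.Base as Sum using (_⊎_; inj₁; inj₂; [_,_]′)
open import Function.Base using (_∘_; id; case_of_)
open import Function.Bundles using (_⇔_; mk⇔; Equivalence)
open import Level using (0ℓ)
open import Relation.Binary.Bundles using (DecTotalOrder)
import Relation.Binary.Construct.NonStrictToStrict as ToStrict
import Relation.Binary.Properties.DecTotalOrder as DecTotalOrderProperties
open import Relation.Binary.PropositionalEquality hiding (J)
import Relation.Binary.Reasoning.PartialOrder as PartialOrderReasoning
open import Relation.Nullary.Decidable using (Dec; yes; no; does; decidable-stable; _×-dec_)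
open import Relation.Nullary.Negation using (¬_; contradiction)

-- Competitiveness compares only with an optimal schedule that is exhibited, so the single stretch
-- has to be proved optimal among all schedules on any number of processors. If the second job is
-- released at `r`, a schedule that starts two intervals by the last deadline `e` costs at least
-- `200 + (51 - r)`, and the single stretch costs `100 + (e - (r - 1))`. The second is at most the
-- first exactly when `e ≤ 150`, so the whole game has to end by time 150; it ends by 51 + 62 + 2 +
-- 31 + 2 = 148.
--
-- The adversary is adaptive, but an algorithm is a function of whole job sets. Lower bounds on
-- spending are therefore stated for every job set with the same arrivals up to `e`, and so survive
-- all later releases.
--
-- With L in place of 50, the opening leaves s = 806 + 106 L against an algorithm that is off at
-- time 0 and s = 11012 - 100 L against one that stays on; these cross near L = 49.5. The map from s
-- to 2.06 s - 9588 has a repelling fixed point near 9045, well above 6112.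
--
-- The order is decidable but the logic is constructive: existence statements about partitions and
-- suprema are double-negated, and are used only to derive inequalities, which are stable.

-- Ordered-field arithmetic and a ring solver with integer coefficients.

module RealProperties (R : Reals) where
  open Reals R

  commutativeRing : CommutativeRing 0ℓ 0ℓ
  commutativeRing = record { isCommutativeRing = isCommutativeRing }

  open CommutativeRing commutativeRing public
    using (+-identityʳ; +-identityˡ; *-identityˡ; *-identityʳ; -‿inverseʳ; zeroˡ; zeroʳ; +-comm; *-comm)
  open Algebra.Properties.Ring (CommutativeRing.ring commutativeRing) public
    using (-‿involutive; -‿distribˡ-*; -‿distribʳ-*; -‿+-comm; -0#≈0#)

  private module Mult = Algebra.Properties.Semiring.Mult (CommutativeRing.semiring commutativeRing)

  fromℕ-× : ∀ n → n Mult.× 1# ≡ fromℕ n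
  fromℕ-× zero    = refl
  fromℕ-× (suc n) = cong (1# +_) (fromℕ-× n)

  fromℕ-+ : ∀ m n → fromℕ (m ℕ.+ n) ≡ fromℕ m + fromℕ n
  fromℕ-+ m n rewrite sym (fromℕ-× (m ℕ.+ n)) | sym (fromℕ-× m) | sym (fromℕ-× n) = Mult.×-homo-+ 1# m n

  fromℕ-* : ∀ m n → fromℕ (m ℕ.* n) ≡ fromℕ m * fromℕ n
  fromℕ-* m n rewrite sym (fromℕ-× (m ℕ.* n)) | sym (fromℕ-× m) | sym (fromℕ-× n) = Mult.×1-homo-* m n

  -- Integer coefficients let the solver evaluate numerals such as 206 by computation in ℤ.
  -- Nonnegative integers go to `fromℕ` on the nose, so solved identities fit terms written with
  -- `fromℕ`.
  fromℤ : ℤ → ℝ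
  fromℤ (ℤ.+ n)    = fromℕ n
  fromℤ -[1+ n ] = - fromℕ (suc n)

  open ≡-Reasoning

  fromℤ-⊖ : ∀ m n → fromℤ (m ⊖ n) ≡ fromℕ m - fromℕ n
  fromℤ-⊖ m zero = sym (trans (cong (fromℕ m +_) -0#≈0#) (+-identityʳ _))
  fromℤ-⊖ zero (suc n) = sym (+-identityˡ _)
  fromℤ-⊖ (suc m) (suc n) = begin
    fromℤ (suc m ⊖ suc n)                     ≡⟨ cong fromℤ (ℤ.[1+m]⊖[1+n]≡m⊖n m n) ⟩
    fromℤ (m ⊖ n)                             ≡⟨ fromℤ-⊖ m n ⟩
    fromℕ m - fromℕ n                         ≡⟨ cong (_- fromℕ n) (+-identityʳ _) ⟨
    fromℕ m + 0# - fromℕ n                    ≡⟨ cong (λ x → fromℕ m + x - fromℕ n) (-‿inverseʳ 1#) ⟨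
    fromℕ m + (1# - 1#) - fromℕ n             ≡⟨ cong (_- fromℕ n) (+-assoc (fromℕ m) 1# (- 1#)) ⟨
    fromℕ m + 1# - 1# - fromℕ n               ≡⟨ +-assoc (fromℕ m + 1#) (- 1#) (- fromℕ n) ⟩
    fromℕ m + 1# + (- 1# - fromℕ n)           ≡⟨ cong₂ _+_ (+-comm (fromℕ m) 1#) (-‿+-comm 1# (fromℕ n)) ⟩
    fromℕ (suc m) - fromℕ (suc n)             ∎
    where open CommutativeRing commutativeRing using (+-assoc)

  fromℤ-neg : ∀ i → fromℤ (ℤ.- i) ≡ - fromℤ i
  fromℤ-neg +0       = sym -0#≈0#
  fromℤ-neg +[1+ n ] = refl
  fromℤ-neg -[1+ n ] = sym (-‿involutive _)

  fromℤ-+ : ∀ i j → fromℤ (i ℤ.+ j) ≡ fromℤ i + fromℤ j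
  fromℤ-+ (ℤ.+ m)    (ℤ.+ n)    = fromℕ-+ m n
  fromℤ-+ (ℤ.+ m)    -[1+ n ] = fromℤ-⊖ m (suc n)
  fromℤ-+ -[1+ m ] (ℤ.+ n)    = trans (fromℤ-⊖ n (suc m)) (+-comm _ _)
  fromℤ-+ -[1+ m ] -[1+ n ] = begin
    - fromℕ (suc (suc (m ℕ.+ n)))         ≡⟨ cong (-_ ∘ fromℕ ∘ suc) (ℕ.+-suc m n) ⟨
    - fromℕ (suc m ℕ.+ suc n)             ≡⟨ cong -_ (fromℕ-+ (suc m) (suc n)) ⟩
    - (fromℕ (suc m) + fromℕ (suc n))     ≡⟨ -‿+-comm _ _ ⟨
    - fromℕ (suc m) - fromℕ (suc n)       ∎

  fromℤ-+◃ : ∀ n → fromℤ (Sign.+ ◃ n) ≡ fromℕ n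
  fromℤ-+◃ n = cong fromℤ (ℤ.+◃n≡+n n)

  fromℤ--◃ : ∀ n → fromℤ (Sign.- ◃ n) ≡ - fromℕ n
  fromℤ--◃ n = trans (cong fromℤ (ℤ.-◃n≡-n n)) (fromℤ-neg (ℤ.+ n))

  fromℤ-* : ∀ i j → fromℤ (i ℤ.* j) ≡ fromℤ i * fromℤ j
  fromℤ-* (ℤ.+ m)    (ℤ.+ n)    = trans (fromℤ-+◃ (m ℕ.* n)) (fromℕ-* m n)
  fromℤ-* (ℤ.+ m)    -[1+ n ] = trans (fromℤ--◃ (m ℕ.* suc n))
    (trans (cong -_ (fromℕ-* m (suc n))) (-‿distribʳ-* _ _))
  fromℤ-* -[1+ m ] (ℤ.+ n)    = trans (fromℤ--◃ (suc m ℕ.* n))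
    (trans (cong -_ (fromℕ-* (suc m) n)) (-‿distribˡ-* _ _))
  fromℤ-* -[1+ m ] -[1+ n ] = begin
    fromℤ (Sign.+ ◃ (suc m ℕ.* suc n))    ≡⟨ fromℤ-+◃ (suc m ℕ.* suc n) ⟩
    fromℕ (suc m ℕ.* suc n)               ≡⟨ fromℕ-* (suc m) (suc n) ⟩
    fromℕ (suc m) * fromℕ (suc n)         ≡⟨ -‿involutive _ ⟨
    - (- (fromℕ (suc m) * fromℕ (suc n))) ≡⟨ cong -_ (-‿distribʳ-* _ _) ⟩
    - (fromℕ (suc m) * - fromℕ (suc n))   ≡⟨ -‿distribˡ-* _ _ ⟩
    - fromℕ (suc m) * - fromℕ (suc n)     ∎

  fromℤ-morphism : CommutativeRing.rawRing ℤ.+-*-commutativeRing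
                   -Raw-AlmostCommutative⟶ fromCommutativeRing commutativeRing
  fromℤ-morphism = record
    { ⟦_⟧    = fromℤ
    ; +-homo = fromℤ-+
    ; *-homo = fromℤ-*
    ; -‿homo = fromℤ-neg
    ; 0-homo = refl
    ; 1-homo = +-identityʳ 1#
    }

  fromℤ-≟ : ∀ i j → Maybe (fromℤ i ≡ fromℤ j)
  fromℤ-≟ i j with i ℤ.≟ j
  ... | yes i≡j = just (cong fromℤ i≡j)
  ... | no  _   = nothing

  module RingSolver = Algebra.Solver.Ring
    (CommutativeRing.rawRing ℤ.+-*-commutativeRing) (fromCommutativeRing commutativeRing)
    fromℤ-morphism fromℤ-≟

  open RingSolver public using (solve; _:=_; _:+_; _:*_; _:-_; :-_; con; Polynomial)

  -- It evaluates to `fromℕ k`, so `♯ 1` means `1# + 0#`. Where a bare `1#` occurs, it is passed to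
  -- the solver as a variable and reconciled by an identity law.
  ♯ : ∀ {n} → ℕ → Polynomial n
  ♯ k = con (ℤ.+ k)

  open DecTotalOrder decTotalOrder public
    using ()
    renaming (antisym to ≤-antisym; total to ≤-total; reflexive to ≤-reflexive)

  open DecTotalOrderProperties decTotalOrder public
    using (≰⇒>; <⇒≱; ≮⇒≥)

  private
    <-≤-trans′ = ToStrict.<-≤-trans _≡_ _≤_ sym ≤-trans ≤-antisym (λ { refl → id })
    ≤-<-trans′ = ToStrict.≤-<-trans _≡_ _≤_ ≤-trans ≤-antisym (λ { refl → id })

  <-≤-trans : ∀ {x y z} → x < y → y ≤ z → x < z
  <-≤-trans = <-≤-trans′

  ≤-<-trans : ∀ {x y z} → x ≤ y → y < z → x < z
  ≤-<-trans = ≤-<-trans′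

  <-irrefl : ∀ {x} → ¬ (x < x)
  <-irrefl (_ , x≢x) = x≢x refl

  infixl 6 _⊕_ _⊕<_ _<⊕_
  infixr 7 _⊗_

  abstract
    _⊕_ : ∀ {a b c d} → a ≤ b → c ≤ d → a + c ≤ b + d
    _⊕_ {a} {b} {c} {d} a≤b c≤d =
      ≤-trans (+-monoˡ-≤ c a≤b) (subst₂ _≤_ (+-comm c b) (+-comm d b) (+-monoˡ-≤ b c≤d))

    +-cancelʳ-≤ : ∀ z {x y} → x + z ≤ y + z → x ≤ y
    +-cancelʳ-≤ z {x} {y} h = subst₂ _≤_ (eq x z) (eq y z) (+-monoˡ-≤ (- z) h)
      where eq : ∀ x z → x + z - z ≡ x
            eq = solve 2 (λ x z → x :+ z :- z := x) refl

    -- Linear arithmetic by certificate: the hypotheses are added up with `_⊕_` and scaled with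
    -- `_⊗_` into one inequality, and the goal differs from it by a ring identity. The identity is
    -- kept free of subtraction on the outside, so it is a direct task for the solver.
    ≤-by : ∀ {l r x y} → l ≤ r → x + r ≡ y + l → x ≤ y
    ≤-by {l} {r} {x} {y} l≤r eq =
      +-cancelʳ-≤ r (subst (_≤ y + r) (sym eq) (≤-refl {y} ⊕ l≤r))

    _⊕<_ : ∀ {a b c d} → a ≤ b → c < d → a + c < b + d
    _⊕<_ {a} {b} {c} {d} a≤b (c≤d , c≢d) = a≤b ⊕ c≤d ,
      λ eq → c≢d (≤-antisym c≤d (≤-by {x = d} {y = c} a≤b (swap d b eq)))
      where
      swap : ∀ d b → a + c ≡ b + d → d + b ≡ c + a
      swap d b eq = trans (+-comm d b) (trans (sym eq) (+-comm a c))

    _<⊕_ : ∀ {a b c d} → a < b → c ≤ d → a + c < b + d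
    _<⊕_ {a} {b} {c} {d} a<b c≤d = subst₂ _<_ (+-comm c a) (+-comm d b) (c≤d ⊕< a<b)

    <-by : ∀ {l r x y} → l < r → x + r ≡ y + l → x < y
    <-by {l} {r} {x} {y} l<r eq = ≤-by (<⇒≤ l<r) eq ,
      λ { refl → <⇒≱ l<r (≤-by (≤-refl {x}) (trans (+-comm r x) (trans eq (+-comm x l)))) }

    *-monoˡ-≤ : ∀ k {a b} → 0# ≤ k → a ≤ b → k * a ≤ k * b
    *-monoˡ-≤ k {a} {b} 0≤k a≤b = ≤-by (*-nonNegative 0≤k (≤-by {x = 0#} {y = b - a} a≤b
        (solve 2 (λ a b → ♯ 0 :+ b := b :- a :+ a) refl a b)))
      (solve 3 (λ k a b → k :* a :+ k :* (b :- a) := k :* b :+ ♯ 0) refl k a b)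

    0<1 : 0# < 1#
    0<1 = [ id , (λ 1≤0 → subst (0# ≤_) -1*-1≡1 (*-nonNegative (0≤-1 1≤0) (0≤-1 1≤0))) ]′ (≤-total 0# 1#) , 0≢1
      where
      0≤-1 : 1# ≤ 0# → 0# ≤ - 1#
      0≤-1 1≤0 = ≤-by 1≤0 (solve 1 (λ o → ♯ 0 :+ ♯ 0 := :- o :+ o) refl 1#)

      -1*-1≡1 : - 1# * - 1# ≡ 1#
      -1*-1≡1 = trans (solve 1 (λ o → :- o :* (:- o) := o :* o) refl 1#) (*-identityˡ 1#)

    fromℕ-nonNeg : ∀ n → 0# ≤ fromℕ n
    fromℕ-nonNeg zero    = ≤-refl
    fromℕ-nonNeg (suc n) = subst (_≤ fromℕ (suc n)) (+-identityʳ 0#) (<⇒≤ 0<1 ⊕ fromℕ-nonNeg n)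

    fromℕ-pos : ∀ n → 0# < fromℕ (suc n)
    fromℕ-pos n = subst (_< fromℕ (suc n)) (+-identityʳ 0#) (0<1 <⊕ fromℕ-nonNeg n)

    _⊗_ : ∀ k {a b} → a ≤ b → fromℕ k * a ≤ fromℕ k * b
    k ⊗ a≤b = *-monoˡ-≤ (fromℕ k) (fromℕ-nonNeg k) a≤b

    pos⇒≢0 : ∀ {x} → 0# < x → x ≢ 0#
    pos⇒≢0 (_ , 0≢x) refl = 0≢x refl

    *-pos : ∀ {x y} → 0# < x → 0# < y → 0# < x * y
    *-pos {x} {y} 0<x 0<y = *-nonNegative (<⇒≤ 0<x) (<⇒≤ 0<y) , λ 0≡xy → proj₂ 0<y (begin
      0#              ≡⟨ zeroʳ (x ⁻¹) ⟨
      x ⁻¹ * 0#       ≡⟨ cong (x ⁻¹ *_) 0≡xy ⟩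
      x ⁻¹ * (x * y)  ≡⟨ solve 3 (λ i x y → i :* (x :* y) := x :* i :* y) refl (x ⁻¹) x y ⟩
      x * x ⁻¹ * y    ≡⟨ cong (_* y) (*-inverseʳ x (pos⇒≢0 0<x)) ⟩
      1# * y          ≡⟨ *-identityˡ y ⟩
      y               ∎)

    ⁻¹-pos : ∀ {x} → 0# < x → 0# < x ⁻¹
    ⁻¹-pos {x} 0<x = ≰⇒> λ x⁻¹≤0 → <⇒≱ 0<1
      (subst₂ _≤_ (*-inverseʳ x (pos⇒≢0 0<x)) (zeroʳ x) (*-monoˡ-≤ x (<⇒≤ 0<x) x⁻¹≤0))

    ⊗-cancel : ∀ k {x y} → fromℕ (suc k) * x ≤ fromℕ (suc k) * y → x ≤ y
    ⊗-cancel k {x} {y} kx≤ky = ≮⇒≥ λ y<x → <⇒≱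
      (*-pos (fromℕ-pos k) (<-by y<x (solve 2 (λ x y → ♯ 0 :+ x := x :- y :+ y) refl x y)))
      (≤-by kx≤ky (solve 3 (λ k x y → k :* (x :- y) :+ k :* y := ♯ 0 :+ k :* x) refl (fromℕ (suc k)) x y))

-- The Henstock-Kurzweil integral: Cousin's lemma, monotonicity, linearity, splitting, step
-- functions.

module IntegralProperties (R : Reals) where
  open Reals R
  open Integration R
  open RealProperties R

  open MinOp minOperator public using (x⊓y≤x; x⊓y≤y)

  ⊓-glb-< : ∀ {x y z} → z < x → z < y → z < x ⊓ y
  ⊓-glb-< {x} {y} z<x z<y with ≤-total x y
  ... | inj₁ _ = z<x
  ... | inj₂ _ = z<y

  abstract
    half third : ℝ → ℝ
    half  x = fromℕ 2 ⁻¹ * x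
    third x = fromℕ 3 ⁻¹ * x

    half-pos : ∀ {x} → 0# < x → 0# < half x
    half-pos = *-pos (⁻¹-pos (fromℕ-pos 1))

    third-pos : ∀ {x} → 0# < x → 0# < third x
    third-pos = *-pos (⁻¹-pos (fromℕ-pos 2))

    half+half : ∀ x → half x + half x ≡ x
    half+half x = trans (solve 2 (λ i x → i :* x :+ i :* x := ♯ 2 :* i :* x) refl (fromℕ 2 ⁻¹) x)
      (trans (cong (_* x) (*-inverseʳ _ (pos⇒≢0 (fromℕ-pos 1)))) (*-identityˡ x))

    third+third+third : ∀ x → third x + third x + third x ≡ x
    third+third+third x = trans
      (solve 2 (λ i x → i :* x :+ i :* x :+ i :* x := ♯ 3 :* i :* x) refl (fromℕ 3 ⁻¹) x)
      (trans (cong (_* x) (*-inverseʳ _ (pos⇒≢0 (fromℕ-pos 2)))) (*-identityˡ x))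

    half< : ∀ {x} → 0# < x → half x < x
    half< {x} 0<x = <-by (half-pos 0<x) (trans (half+half x) (sym (+-identityʳ x)))

    x<x+y : ∀ {x y} → 0# < y → x < x + y
    x<x+y {x} {y} 0<y = <-by 0<y (solve 2 (λ x y → x :+ y := x :+ y :+ ♯ 0) refl x y)

    x-y<x : ∀ {x y} → 0# < y → x - y < x
    x-y<x {x} {y} 0<y = <-by 0<y (solve 2 (λ x y → x :- y :+ y := x :+ ♯ 0) refl x y)

    0<y-x : ∀ {x y} → x < y → 0# < y - x
    0<y-x {x} {y} x<y = <-by x<y (solve 2 (λ x y → ♯ 0 :+ y := y :- x :+ x) refl x y)

    0≤y-x : ∀ {x y} → x ≤ y → 0# ≤ y - x
    0≤y-x {x} {y} x≤y = ≤-by x≤y (solve 2 (λ x y → ♯ 0 :+ y := y :- x :+ x) refl x y)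

  -- The premise may be double-negated because the conclusion is stable. Three copies of `ε` are
  -- allowed since splitting an integral compares three Riemann sums at once.
  ≤-limit : ∀ {x y} → (∀ ε → 0# < ε → ¬ ¬ (x < y + (ε + ε + ε))) → x ≤ y
  ≤-limit {x} {y} h = ≮⇒≥ λ y<x → h (third (x - y)) (third-pos (0<y-x y<x)) λ lt →
    <-irrefl (subst (x <_) (trans (cong (y +_) (third+third+third (x - y)))
      (solve 2 (λ x y → y :+ (x :- y) := x) refl x y)) lt)

  -- Let `s` be the supremum of the points of `[a, b]` satisfying `P`. Then `limit` gives `P s`, and
  -- `step` would pass beyond `s` if `s < b`. The existence premises enter only into proofs of
  -- inequalities, so their double negations suffice while the conclusion has none.
  realInduction : (P : ℝ → Set) → ∀ {a b} → a ≤ b → P a →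
    (∀ x → a ≤ x → x < b → P x → ¬ ¬ (∃[ y ] x < y × y ≤ b × P y)) →
    (∀ x → a ≤ x → x ≤ b → (∀ y → y < x → ¬ ¬ (∃[ z ] y < z × a ≤ z × z ≤ x × P z)) → P x) →
    P b
  realInduction P {a} {b} a≤b Pa step limit
    with complete (λ x → a ≤ x × x ≤ b × P x) (a , ≤-refl , a≤b , Pa) (b , λ _ → proj₁ ∘ proj₂)
  ... | s , upper , least = subst P (≤-antisym s≤b b≤s) Ps
    where
    a≤s = upper a (≤-refl , a≤b , Pa)
    s≤b = least b (λ _ → proj₁ ∘ proj₂)
    Ps = limit s a≤s s≤b λ y y<s none → <⇒≱ y<s (least y λ z (a≤z , z≤b , Pz) →
      ≮⇒≥ λ y<z → none (z , y<z , a≤z , upper z (a≤z , z≤b , Pz) , Pz))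
    b≤s = ≮⇒≥ λ s<b → step s a≤s s<b Ps λ (y , s<y , y≤b , Py) →
      <⇒≱ s<y (upper y (≤-trans a≤s (<⇒≤ s<y) , y≤b , Py))

  partition⇒≤ : ∀ {a b} → TaggedPartition a b → a ≤ b
  partition⇒≤ []                        = ≤-refl
  partition⇒≤ (add _ _ a≤tag tag≤u p) = ≤-trans a≤tag (≤-trans tag≤u (partition⇒≤ p))

  infixr 5 _++ₚ_ _++ᶠ_

  _++ₚ_ : ∀ {a b c} → TaggedPartition a b → TaggedPartition b c → TaggedPartition a c
  []                         ++ₚ q = q
  add u tag a≤tag tag≤u p ++ₚ q = add u tag a≤tag tag≤u (p ++ₚ q)

  _++ᶠ_ : ∀ {γ a b c} {p : TaggedPartition a b} {q : TaggedPartition b c} →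
          Fine γ p → Fine γ q → Fine γ (p ++ₚ q)
  []       ++ᶠ fq = fq
  add f fp ++ᶠ fq = add f (fp ++ᶠ fq)

  Fine-mono : ∀ {γ γ′} → (∀ x → γ x ≤ γ′ x) → ∀ {a b} {p : TaggedPartition a b} →
              Fine γ p → Fine γ′ p
  Fine-mono γ≤γ′ []        = []
  Fine-mono γ≤γ′ (add f fp) = add (<-≤-trans f (γ≤γ′ _)) (Fine-mono γ≤γ′ fp)

  -- Cousin's lemma. Without it `HasIntegral` could hold vacuously for every value; it underlies
  -- uniqueness, monotonicity and splitting.
  cousin : ∀ {γ a b} → (∀ x → 0# < γ x) → a ≤ b → ¬ ¬ (Σ[ p ∈ TaggedPartition a b ] Fine γ p)
  cousin {γ} {a} {b} γ-pos a≤b =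
    realInduction (λ x → ¬ ¬ (Σ[ p ∈ TaggedPartition a x ] Fine γ p)) a≤b
      (λ none → none ([] , [])) step limit
    where
    extend : ∀ {x y} tag → x ≤ tag → tag ≤ y → y - x < γ tag →
             ¬ ¬ (Σ[ p ∈ TaggedPartition a x ] Fine γ p) →
             ¬ ¬ (Σ[ p ∈ TaggedPartition a y ] Fine γ p)
    extend tag x≤tag tag≤y fine some none = some λ (p , fp) →
      none (p ++ₚ add _ tag x≤tag tag≤y [] , fp ++ᶠ add fine [])

    step : ∀ x → a ≤ x → x < b → ¬ ¬ (Σ[ p ∈ TaggedPartition a x ] Fine γ p) →
           ¬ ¬ (∃[ y ] x < y × y ≤ b × ¬ ¬ (Σ[ p ∈ TaggedPartition a y ] Fine γ p))
    -- The new cell is tagged at its left end `x` and has length at most `half (γ x)`, since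
    -- fineness asks for strictly less than `γ x`.
    step x _ x<b Px none with b ≤? x + half (γ x)
    ... | yes b≤ = none (b , x<b , ≤-refl , extend x ≤-refl (<⇒≤ x<b)
            (≤-<-trans (≤-by b≤ (solve 3 (λ x b h → b :- x :+ (x :+ h) := h :+ b) refl x b (half (γ x))))
                       (half< (γ-pos x))) Px)
    ... | no  b≰ = none (x + half (γ x) , x<x+y (half-pos (γ-pos x)) , <⇒≤ (≰⇒> b≰) ,
            extend x ≤-refl (<⇒≤ (x<x+y (half-pos (γ-pos x))))
              (subst (_< γ x) (solve 2 (λ x h → h := x :+ h :- x) refl x (half (γ x))) (half< (γ-pos x))) Px)

    limit : ∀ x → a ≤ x → x ≤ b →
            (∀ y → y < x → ¬ ¬ (∃[ z ] y < z × a ≤ z × z ≤ x × ¬ ¬ (Σ[ p ∈ TaggedPartition a z ] Fine γ p))) →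
            ¬ ¬ (Σ[ p ∈ TaggedPartition a x ] Fine γ p)
    -- Here the cell is tagged at its right end: `γ x` is fixed before `z` is chosen, whereas `γ z`
    -- might be too small to reach `x`.
    limit x _ _ near none = near (x - γ x) (x-y<x (γ-pos x)) λ (z , x-γ<z , _ , z≤x , Pz) →
      extend x z≤x ≤-refl
        (<-by x-γ<z (solve 3 (λ x z g → x :- z :+ z := g :+ (x :- g)) refl x z (γ x))) Pz none

  riemannSum-++ : ∀ f {a b c} (p : TaggedPartition a b) (q : TaggedPartition b c) →
                  riemannSum f (p ++ₚ q) ≡ riemannSum f p + riemannSum f q
  riemannSum-++ f []                q = sym (+-identityˡ _)
  riemannSum-++ f (add u tag _ _ p) q = trans (cong (_ +_) (riemannSum-++ f p q))
    (solve 3 (λ x y z → x :+ (y :+ z) := x :+ y :+ z) refl _ _ _)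

  riemannSum-mono : ∀ {f g a b} (p : TaggedPartition a b) →
                    (∀ t → a ≤ t → t ≤ b → f t ≤ g t) → riemannSum f p ≤ riemannSum g p
  riemannSum-mono [] f≤g = ≤-refl
  riemannSum-mono {f} {g} {a} (add u tag a≤tag tag≤u p) f≤g =
    subst₂ _≤_ (*-comm (u - a) (f tag)) (*-comm (u - a) (g tag))
      (*-monoˡ-≤ (u - a) (0≤y-x (≤-trans a≤tag tag≤u))
        (f≤g tag a≤tag (≤-trans tag≤u (partition⇒≤ p))))
    ⊕ riemannSum-mono p (λ t u≤t → f≤g t (≤-trans (≤-trans a≤tag tag≤u) u≤t))

  riemannSum-cong : ∀ {f g a b} (p : TaggedPartition a b) →
                    (∀ t → a ≤ t → t ≤ b → f t ≡ g t) → riemannSum f p ≡ riemannSum g p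
  riemannSum-cong p f≡g = ≤-antisym (riemannSum-mono p λ t a≤t t≤b → ≤-reflexive (f≡g t a≤t t≤b))
                                    (riemannSum-mono p λ t a≤t t≤b → ≤-reflexive (sym (f≡g t a≤t t≤b)))

  riemannSum-const : ∀ k {a b} (p : TaggedPartition a b) → riemannSum (λ _ → k) p ≡ k * (b - a)
  riemannSum-const k {a} [] = solve 2 (λ k a → ♯ 0 := k :* (a :- a)) refl k a
  riemannSum-const k {a} {b} (add u _ _ _ p) = trans (cong (_ +_) (riemannSum-const k p))
    (solve 4 (λ k a b u → k :* (u :- a) :+ k :* (b :- u) := k :* (b :- a)) refl k a b u)

  riemannSum-+ : ∀ f g {a b} (p : TaggedPartition a b) →
                 riemannSum (λ t → f t + g t) p ≡ riemannSum f p + riemannSum g p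
  riemannSum-+ f g [] = sym (+-identityˡ 0#)
  riemannSum-+ f g (add u tag _ _ p) = trans (cong (_ +_) (riemannSum-+ f g p))
    (solve 5 (λ x y w s t → (x :+ y) :* w :+ (s :+ t) := x :* w :+ s :+ (y :* w :+ t)) refl
      (f tag) (g tag) _ _ _)

  riemannSum-* : ∀ k f {a b} (p : TaggedPartition a b) →
                 riemannSum (λ t → k * f t) p ≡ k * riemannSum f p
  riemannSum-* k f [] = sym (zeroʳ k)
  riemannSum-* k f (add u tag _ _ p) = trans (cong (_ +_) (riemannSum-* k f p))
    (solve 4 (λ k x w s → k :* x :* w :+ k :* s := k :* (x :* w :+ s)) refl k (f tag) _ _)

  riemannSum-neg : ∀ f {a b} (p : TaggedPartition a b) → riemannSum (λ t → - f t) p ≡ - riemannSum f p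
  riemannSum-neg f [] = solve 0 (♯ 0 := :- ♯ 0) refl
  riemannSum-neg f (add u tag _ _ p) = trans (cong (_ +_) (riemannSum-neg f p))
    (solve 3 (λ x w s → :- x :* w :+ :- s := :- (x :* w :+ s)) refl (f tag) _ _)

  -- Non-strict bounds for `half ε` are strict bounds for `ε`.
  weaken-bounds : ∀ {f a b v} →
    (∀ ε → 0# < ε → Σ[ γ ∈ (ℝ → ℝ) ] (∀ x → 0# < γ x) ×
      (∀ (p : TaggedPartition a b) → Fine γ p →
        (v - ε ≤ riemannSum f p) × (riemannSum f p ≤ v + ε))) →
    HasIntegral f a b v
  weaken-bounds {v = v} h ε 0<ε with h (half ε) (half-pos 0<ε)
  ... | γ , γ-pos , bounds = γ , γ-pos , λ p fp →
    <-≤-trans lower< (proj₁ (bounds p fp)) , ≤-<-trans (proj₂ (bounds p fp)) upper<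
    where
    lower< : v - ε < v - half ε
    lower< = <-by (half< 0<ε) (solve 3 (λ v e h → v :- e :+ e := v :- h :+ h) refl v ε (half ε))
    upper< : v + half ε < v + ε
    upper< = <-by (half< 0<ε) (solve 3 (λ v e h → v :+ h :+ e := v :+ e :+ h) refl v ε (half ε))

  -- A partition fine for the minimum of both gauges makes both Riemann sums accurate, and there
  -- they compare term by term.
  HasIntegral-mono : ∀ {f g a b v w} → HasIntegral f a b v → HasIntegral g a b w → a ≤ b →
                     (∀ t → a ≤ t → t ≤ b → f t ≤ g t) → v ≤ w
  HasIntegral-mono {f} {g} {v = v} {w} If Ig a≤b f≤g = ≤-limit λ ε 0<ε none →
    let γ₁ , γ₁-pos , bounds₁ = If ε 0<ε
        γ₂ , γ₂-pos , bounds₂ = Ig ε 0<ε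
    in cousin (λ x → ⊓-glb-< (γ₁-pos x) (γ₂-pos x)) a≤b λ (p , fp) → none
      (<-by (proj₁ (bounds₁ p (Fine-mono (λ x → x⊓y≤x _ _) fp))
             <⊕ riemannSum-mono p f≤g
             <⊕ <⇒≤ (proj₂ (bounds₂ p (Fine-mono (λ x → x⊓y≤y (γ₁ x) _) fp)))
             <⊕ <⇒≤ 0<ε)
        (solve 5 (λ v w e r s → v :+ (r :+ s :+ (w :+ e) :+ e)
                                := w :+ (e :+ e :+ e) :+ (v :- e :+ r :+ s :+ ♯ 0)) refl v w ε (riemannSum f p) (riemannSum g p)))

  HasIntegral-unique : ∀ {f a b v w} → HasIntegral f a b v → HasIntegral f a b w → a ≤ b → v ≡ w
  HasIntegral-unique Iv Iw a≤b = ≤-antisym (HasIntegral-mono Iv Iw a≤b λ _ _ _ → ≤-refl)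
                                           (HasIntegral-mono Iw Iv a≤b λ _ _ _ → ≤-refl)

  HasIntegral-cong : ∀ {f g a b v} → (∀ t → a ≤ t → t ≤ b → f t ≡ g t) →
                     HasIntegral f a b v → HasIntegral g a b v
  HasIntegral-cong f≡g If ε 0<ε with If ε 0<ε
  ... | γ , γ-pos , bounds = γ , γ-pos , λ p fp →
    subst (λ r → _ < r × r < _) (riemannSum-cong p f≡g) (bounds p fp)

  HasIntegral-const : ∀ k {a b} → HasIntegral (λ _ → k) a b (k * (b - a))
  HasIntegral-const k {a} {b} ε 0<ε = (λ _ → 1#) , (λ _ → 0<1) , λ p _ →
    subst (λ r → _ < r × r < _) (sym (riemannSum-const k p)) (x-y<x 0<ε , x<x+y 0<ε)

  HasIntegral-+ : ∀ {f g a b v w} → HasIntegral f a b v → HasIntegral g a b w →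
                  HasIntegral (λ t → f t + g t) a b (v + w)
  HasIntegral-+ {f} {g} {v = v} {w} If Ig ε 0<ε
    with If (half ε) (half-pos 0<ε) | Ig (half ε) (half-pos 0<ε)
  ... | γ₁ , γ₁-pos , bounds₁ | γ₂ , γ₂-pos , bounds₂ =
    (λ x → γ₁ x ⊓ γ₂ x) , (λ x → ⊓-glb-< (γ₁-pos x) (γ₂-pos x)) , λ p fp →
      let l₁ , u₁ = bounds₁ p (Fine-mono (λ x → x⊓y≤x _ _) fp)
          l₂ , u₂ = bounds₂ p (Fine-mono (λ x → x⊓y≤y (γ₁ x) _) fp)
      in subst₂ _<_
           (trans (solve 3 (λ v w h → v :- h :+ (w :- h) := v :+ w :- (h :+ h)) refl v w (half ε))
                  (cong (λ e → v + w - e) (half+half ε)))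
           (sym (riemannSum-+ f g p)) (l₁ <⊕ <⇒≤ l₂) ,
         subst₂ _<_ (sym (riemannSum-+ f g p))
           (trans (solve 3 (λ v w h → v :+ h :+ (w :+ h) := v :+ w :+ (h :+ h)) refl v w (half ε))
                  (cong (λ e → v + w + e) (half+half ε)))
           (u₁ <⊕ <⇒≤ u₂)

  -- The gauge is taken for `ε` divided by `1# + k` rather than by `k`, which may be zero.
  HasIntegral-*-nonNeg : ∀ {f a b v} k → 0# ≤ k → HasIntegral f a b v →
                         HasIntegral (λ t → k * f t) a b (k * v)
  HasIntegral-*-nonNeg {f} {a} {b} {v} k 0≤k If = weaken-bounds bounds
    where
    0<1+k : 0# < 1# + k
    0<1+k = subst (_< 1# + k) (+-identityʳ 0#) (0<1 <⊕ 0≤k)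

    bounds : ∀ ε → 0# < ε → Σ[ γ ∈ (ℝ → ℝ) ] (∀ x → 0# < γ x) ×
             (∀ (p : TaggedPartition a b) → Fine γ p →
               (k * v - ε ≤ riemannSum (λ t → k * f t) p) ×
               (riemannSum (λ t → k * f t) p ≤ k * v + ε))
    bounds ε 0<ε with If ((1# + k) ⁻¹ * ε) (*-pos (⁻¹-pos 0<1+k) 0<ε)
    ... | γ , γ-pos , bound = γ , γ-pos , λ p fp →
      let ε′ = (1# + k) ⁻¹ * ε
          kε′≤ε : k * ε′ ≤ ε
          kε′≤ε = ≤-by (<⇒≤ (*-pos (⁻¹-pos 0<1+k) 0<ε)) (trans
            (solve 3 (λ k i e → k :* (i :* e) :+ i :* e := (♯ 1 :+ k) :* i :* e) refl k ((1# + k) ⁻¹) ε)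
            (trans (cong (λ o → (o + k) * (1# + k) ⁻¹ * ε) (+-identityʳ 1#))
              (trans (cong (_* ε) (*-inverseʳ (1# + k) (pos⇒≢0 0<1+k)))
                (trans (*-identityˡ ε) (sym (+-identityʳ ε))))))
          l , u = bound p fp
      in subst (_ ≤_) (sym (riemannSum-* k f p))
           (≤-by (*-monoˡ-≤ k 0≤k (<⇒≤ l) ⊕ kε′≤ε)
             (solve 5 (λ k v e e′ r → k :* v :- e :+ (k :* r :+ e) := k :* r :+ (k :* (v :- e′) :+ k :* e′))
               refl k v ε ε′ (riemannSum f p))) ,
         subst (_≤ _) (sym (riemannSum-* k f p))
           (≤-by (*-monoˡ-≤ k 0≤k (<⇒≤ u) ⊕ kε′≤ε)
             (solve 5 (λ k v e e′ r → k :* r :+ (k :* (v :+ e′) :+ e) := k :* v :+ e :+ (k :* r :+ k :* e′))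
               refl k v ε ε′ (riemannSum f p)))

  HasIntegral-neg : ∀ {f a b v} → HasIntegral f a b v → HasIntegral (λ t → - f t) a b (- v)
  HasIntegral-neg {f} {v = v} If ε 0<ε with If ε 0<ε
  ... | γ , γ-pos , bounds = γ , γ-pos , λ p fp →
    let l , u = bounds p fp
        eq = riemannSum-neg f p
    in subst (_ <_) (sym eq) (<-by u (solve 3 (λ v e r → :- v :- e :+ (v :+ e) := :- r :+ r) refl v ε (riemannSum f p))) ,
       subst (_< _) (sym eq) (<-by l (solve 3 (λ v e r → :- r :+ r := :- v :+ e :+ (v :- e)) refl v ε (riemannSum f p)))

  HasIntegral-* : ∀ {f a b v} k → HasIntegral f a b v → HasIntegral (λ t → k * f t) a b (k * v)
  HasIntegral-* {f} {v = v} k If with ≤-total 0# k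
  ... | inj₁ 0≤k = HasIntegral-*-nonNeg k 0≤k If
  ... | inj₂ k≤0 = subst (HasIntegral _ _ _) (neg-neg v)
    (HasIntegral-cong (λ t _ _ → neg-neg (f t)) (HasIntegral-neg (HasIntegral-*-nonNeg (- k)
      (≤-by k≤0 (solve 1 (λ k → ♯ 0 :+ ♯ 0 := :- k :+ k) refl k)) If)))
    where
    neg-neg : ∀ x → - (- k * x) ≡ k * x
    neg-neg = solve 2 (λ k x → :- (:- k :* x) := k :* x) refl k

  -- Fine partitions of the two halves concatenate to a fine partition of the whole, whose Riemann
  -- sum is the sum of theirs.
  HasIntegral-split : ∀ {f a m b v v₁ v₂} → a ≤ m → m ≤ b → HasIntegral f a b v →
                      HasIntegral f a m v₁ → HasIntegral f m b v₂ → v ≡ v₁ + v₂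
  HasIntegral-split {f} {a} {m} {b} {v} {v₁} {v₂} a≤m m≤b I I₁ I₂ = ≤-antisym
    (≤-limit λ ε 0<ε none → bounds ε 0<ε λ (r₁ , r₂ , (l , u) , (l₁ , u₁) , (l₂ , u₂)) → none
      (<-by (l <⊕ <⇒≤ (u₁ <⊕ <⇒≤ u₂))
        (solve 6 (λ v v₁ v₂ e r₁ r₂ → v :+ (r₁ :+ r₂ :+ (v₁ :+ e :+ (v₂ :+ e)))
                   := v₁ :+ v₂ :+ (e :+ e :+ e) :+ (v :- e :+ (r₁ :+ r₂))) refl v v₁ v₂ ε r₁ r₂)))
    (≤-limit λ ε 0<ε none → bounds ε 0<ε λ (r₁ , r₂ , (l , u) , (l₁ , u₁) , (l₂ , u₂)) → none
      (<-by (u <⊕ <⇒≤ (l₁ <⊕ <⇒≤ l₂))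
        (solve 6 (λ v v₁ v₂ e r₁ r₂ → v₁ :+ v₂ :+ (v :+ e :+ (r₁ :+ r₂))
                   := v :+ (e :+ e :+ e) :+ (r₁ :+ r₂ :+ (v₁ :- e :+ (v₂ :- e)))) refl v v₁ v₂ ε r₁ r₂)))
    where
    bounds : ∀ ε → 0# < ε → ¬ ¬ (∃[ r₁ ] ∃[ r₂ ] (v - ε < r₁ + r₂ × r₁ + r₂ < v + ε) ×
                                  (v₁ - ε < r₁ × r₁ < v₁ + ε) × (v₂ - ε < r₂ × r₂ < v₂ + ε))
    bounds ε 0<ε none =
      let γ , γ-pos , bound = I ε 0<ε
          γ₁ , γ₁-pos , bound₁ = I₁ ε 0<ε
          γ₂ , γ₂-pos , bound₂ = I₂ ε 0<ε
      in cousin (λ x → ⊓-glb-< (γ-pos x) (γ₁-pos x)) a≤m λ (p , fp) →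
         cousin (λ x → ⊓-glb-< (γ-pos x) (γ₂-pos x)) m≤b λ (q , fq) →
         none (riemannSum f p , riemannSum f q ,
           subst (λ r → v - ε < r × r < v + ε) (riemannSum-++ f p q)
             (bound (p ++ₚ q) (Fine-mono (λ x → x⊓y≤x _ _) fp ++ᶠ Fine-mono (λ x → x⊓y≤x _ _) fq)) ,
           bound₁ p (Fine-mono (λ x → x⊓y≤y (γ x) _) fp) ,
           bound₂ q (Fine-mono (λ x → x⊓y≤y (γ x) _) fq))

  -- The building block of all functions integrated along the constructed schedules: each is a
  -- combination of such steps and a constant.
  heaviside : ℝ → ℝ → ℝ
  heaviside u t = if does (u ≤? t) then 1# else 0#

  heaviside-1 : ∀ {u t} → u ≤ t → heaviside u t ≡ 1#
  heaviside-1 {u} {t} u≤t with u ≤? t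
  ... | yes _   = refl
  ... | no u≰t = contradiction u≤t u≰t

  heaviside-0 : ∀ {u t} → t < u → heaviside u t ≡ 0#
  heaviside-0 {u} {t} t<u with u ≤? t
  ... | yes u≤t = contradiction u≤t (<⇒≱ t<u)
  ... | no _    = refl

  -- Cells before `u` contribute nothing and cells after it their full width. Only the cell around
  -- `u` can err, by at most its width, whichever side its tag is on.
  riemannSum-heaviside : ∀ {u ε a b} (p : TaggedPartition a b) → Fine (λ _ → ε) p → 0# < ε →
    a ≤ u → u ≤ b → (b - u - ε ≤ riemannSum (heaviside u) p) × (riemannSum (heaviside u) p ≤ b - u + ε)
  riemannSum-heaviside {u} {ε} {a} [] [] 0<ε a≤u u≤a =
    ≤-by (a≤u ⊕ <⇒≤ 0<ε) (solve 3 (λ a u e → a :- u :- e :+ (u :+ e) := ♯ 0 :+ (a :+ ♯ 0)) refl a u ε) ,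
    ≤-by (u≤a ⊕ <⇒≤ 0<ε) (solve 3 (λ a u e → ♯ 0 :+ (a :+ e) := a :- u :+ e :+ (u :+ ♯ 0)) refl a u ε)
  riemannSum-heaviside {u} {ε} {a} {b} (add w tag a≤tag tag≤w p) (add w-a<ε fp) 0<ε a≤u u≤b with u ≤? w
  ... | no u≰w = subst (λ r → (b - u - ε ≤ r) × (r ≤ b - u + ε)) eq
                   (riemannSum-heaviside p fp 0<ε (<⇒≤ (≰⇒> u≰w)) u≤b)
    where
    eq : riemannSum (heaviside u) p ≡ heaviside u tag * (w - a) + riemannSum (heaviside u) p
    eq = trans (solve 2 (λ r d → r := ♯ 0 :* d :+ r) refl (riemannSum (heaviside u) p) (w - a))
           (cong (λ h → h * (w - a) + _) (sym (heaviside-0 (≤-<-trans tag≤w (≰⇒> u≰w)))))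
  ... | yes u≤w = subst (λ r → (b - u - ε ≤ _ + r) × (_ + r ≤ b - u + ε)) (sym eq) cell
    where
    eq : riemannSum (heaviside u) p ≡ b - w
    eq = trans (riemannSum-cong p λ t w≤t _ → heaviside-1 (≤-trans u≤w w≤t))
           (trans (riemannSum-const 1# p) (*-identityˡ _))

    cell : (b - u - ε ≤ heaviside u tag * (w - a) + (b - w)) ×
           (heaviside u tag * (w - a) + (b - w) ≤ b - u + ε)
    cell with u ≤? tag
    ... | yes _ rewrite *-identityˡ (w - a) =
      ≤-by (a≤u ⊕ <⇒≤ 0<ε) (solve 5 (λ a b u w e → b :- u :- e :+ (u :+ e) := w :- a :+ (b :- w) :+ (a :+ ♯ 0)) refl a b u w ε) ,
      ≤-by (u≤w ⊕ <⇒≤ w-a<ε) (solve 5 (λ a b u w e → w :- a :+ (b :- w) :+ (w :+ e) := b :- u :+ e :+ (u :+ (w :- a))) refl a b u w ε)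
    ... | no _ rewrite zeroˡ (w - a) =
      ≤-by (a≤u ⊕ <⇒≤ w-a<ε) (solve 5 (λ a b u w e → b :- u :- e :+ (u :+ e) := ♯ 0 :+ (b :- w) :+ (a :+ (w :- a))) refl a b u w ε) ,
      ≤-by (u≤w ⊕ <⇒≤ 0<ε) (solve 4 (λ b u w e → ♯ 0 :+ (b :- w) :+ (w :+ e) := b :- u :+ e :+ (u :+ ♯ 0)) refl b u w ε)

  HasIntegral-heaviside : ∀ {u a b} → a ≤ u → u ≤ b → HasIntegral (heaviside u) a b (b - u)
  HasIntegral-heaviside a≤u u≤b = weaken-bounds λ ε 0<ε →
    (λ _ → ε) , (λ _ → 0<ε) , λ p fp → riemannSum-heaviside p fp 0<ε a≤u u≤b

  Integrable-heaviside : ∀ u a b → Integrable (heaviside u) a b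
  Integrable-heaviside u a b with u ≤? a | u ≤? b
  ... | yes u≤a | _       = _ , HasIntegral-cong (λ t a≤t _ → sym (heaviside-1 (≤-trans u≤a a≤t))) (HasIntegral-const 1#)
  ... | no  _   | no u≰b  = _ , HasIntegral-cong (λ t _ t≤b → sym (heaviside-0 (≤-<-trans t≤b (≰⇒> u≰b)))) (HasIntegral-const 0#)
  ... | no  u≰a | yes u≤b = _ , HasIntegral-heaviside (<⇒≤ (≰⇒> u≰a)) u≤b

  -- As `h` is constantly `k₀` from `u` on, the override adds `k - k₀` times a single step.
  Integrable-override : ∀ {h a b} u k k₀ → (∀ t → u ≤ t → h t ≡ k₀) → Integrable h a b →
                        Integrable (λ t → if does (u ≤? t) then k else h t) a b
  Integrable-override {h} {a} {b} u k k₀ h≡k₀ (_ , Ih) =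
    _ , HasIntegral-cong (λ t _ _ → eq t)
          (HasIntegral-+ Ih (HasIntegral-* (k - k₀) (proj₂ (Integrable-heaviside u a b))))
    where
    eq : ∀ t → h t + (k - k₀) * heaviside u t ≡ (if does (u ≤? t) then k else h t)
    eq t with u ≤? t
    ... | yes u≤t rewrite h≡k₀ t u≤t | *-identityʳ (k - k₀) = solve 2 (λ k₀ k → k₀ :+ (k :- k₀) := k) refl k₀ k
    ... | no  _   rewrite zeroʳ (k - k₀) = +-identityʳ (h t)

-- Energy as switch-ons plus on-time, and lower bounds on it.

module ScheduleProperties (R : Reals) where
  open Scheduling R
  open RealProperties R
  open IntegralProperties R
  open MaxOp maxOperator using (⊔-mono-≤; x≤y⊔x)
  open MaxOperator maxOperator using (x≤y⇒x⊔y≈y; x≥y⇒x⊔y≈x)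

  ⊓-glb-≤ : ∀ {x y z} → z ≤ x → z ≤ y → z ≤ x ⊓ y
  ⊓-glb-≤ {x} {y} z≤x z≤y with ≤-total x y
  ... | inj₁ _ = z≤x
  ... | inj₂ _ = z≤y

  sum-mono : ∀ {A : Set} {f g : A → ℝ} (xs : List A) → (∀ x → f x ≤ g x) → sum (map f xs) ≤ sum (map g xs)
  sum-mono []       f≤g = ≤-refl
  sum-mono (x ∷ xs) f≤g = f≤g x ⊕ sum-mono xs f≤g

  sum-mono-gain : ∀ {A : Set} {f g : A → ℝ} {d x xs} → (∀ x → f x ≤ g x) →
                  x ∈ xs → f x + d ≤ g x → sum (map f xs) + d ≤ sum (map g xs)
  sum-mono-gain {f = f} {g} {d} {xs = x ∷ xs} f≤g (here refl) gain =
    ≤-by (gain ⊕ sum-mono xs f≤g)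
      (solve 5 (λ a b c d e → a :+ e :+ c :+ (b :+ d) := b :+ d :+ (a :+ c :+ e)) refl (f x) (g x) d _ _)
  sum-mono-gain {f = f} {g} {d} {xs = x ∷ xs} f≤g (there x∈xs) gain =
    ≤-by (f≤g x ⊕ sum-mono-gain f≤g x∈xs gain)
      (solve 5 (λ a b c d e → a :+ d :+ c :+ (b :+ e) := b :+ e :+ (a :+ (d :+ c))) refl (f x) (g x) d _ _)

  sum-zero : ∀ {A : Set} (xs : List A) → sum (map (λ _ → 0#) xs) ≡ 0#
  sum-zero []       = refl
  sum-zero (_ ∷ xs) = trans (+-identityˡ _) (sum-zero xs)

  sum-∈ : ∀ {A : Set} {f : A → ℝ} {x xs} → (∀ x → 0# ≤ f x) → x ∈ xs → f x ≤ sum (map f xs)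
  sum-∈ {f = f} {x} {xs} 0≤f x∈xs = subst (_≤ sum (map f xs)) (trans (cong (_+ f x) (sum-zero xs)) (+-identityˡ _))
    (sum-mono-gain 0≤f x∈xs (≤-reflexive (+-identityˡ _)))

  sum-++ : ∀ xs ys → sum (xs ++ ys) ≡ sum xs + sum ys
  sum-++ []       ys = sym (+-identityˡ _)
  sum-++ (x ∷ xs) ys = trans (cong (x +_) (sum-++ xs ys))
    (solve 3 (λ x y z → x :+ (y :+ z) := x :+ y :+ z) refl x (sum xs) (sum ys))

  sum-concatMap : ∀ {A B : Set} (f : B → ℝ) (h : A → List B) xs →
                  sum (map f (concatMap h xs)) ≡ sum (map (λ x → sum (map f (h x))) xs)
  sum-concatMap f h []       = refl
  sum-concatMap f h (x ∷ xs) = trans (cong sum (map-++ f (h x) (concatMap h xs)))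
    (trans (sum-++ (map f (h x)) _) (cong (sum (map f (h x)) +_) (sum-concatMap f h xs)))

  sum-pos : ∀ {A : Set} {f : A → ℝ} xs → 0# < sum (map f xs) → ∃[ x ] x ∈ xs × 0# < f x
  sum-pos []       0<0 = contradiction 0<0 <-irrefl
  sum-pos {f = f} (x ∷ xs) 0<sum with f x ≤? 0#
  ... | no fx≰0  = x , here refl , ≰⇒> fx≰0
  ... | yes fx≤0 with sum-pos {f = f} xs (<-by (0<sum <⊕ fx≤0)
                        (solve 2 (λ a b → ♯ 0 :+ (a :+ b :+ ♯ 0) := b :+ (♯ 0 :+ a)) refl (f x) _))
  ...   | y , y∈xs , 0<fy = y , there y∈xs , 0<fy

  clamp : Interval → ℝ → ℝ
  clamp I t = start I ⊔ (stop I ⊓ t)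

  clamp-mono : ∀ I {u v} → u ≤ v → clamp I u ≤ clamp I v
  clamp-mono I {u} u≤v = ⊔-mono-≤ (≤-refl {start I})
    (⊓-glb-≤ (x⊓y≤x (stop I) u) (≤-trans (x⊓y≤y (stop I) u) u≤v))

  clamp-inside : ∀ I {t} → start I ≤ t → t ≤ stop I → clamp I t ≡ t
  clamp-inside I {t} s≤t t≤e = trans (cong (start I ⊔_) (≤-antisym (x⊓y≤y (stop I) t) (⊓-glb-≤ t≤e ≤-refl)))
                                 (x≤y⇒x⊔y≈y s≤t)

  start≤clamp : ∀ I t → start I ≤ clamp I t
  start≤clamp I t = x≤x⊔y (start I) _

  clamp≤stop : ∀ I t → clamp I t ≤ stop I
  clamp≤stop I t = subst (clamp I t ≤_) (x≤y⇒x⊔y≈y (<⇒≤ (start<stop I)))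
    (⊔-mono-≤ (≤-refl {start I}) (x⊓y≤x (stop I) t))

  -- The limits of integration in ∫[_∩[_,_]].
  lower : Interval → ℝ → ℝ
  lower I a = start I ⊔ a

  upper : Interval → ℝ → ℝ → ℝ
  upper I a d = lower I a ⊔ (stop I ⊓ d)

  -- The second case is the degenerate one, where both limits of integration coincide.
  upper-cases : ∀ I a d → upper I a d ≡ stop I ⊓ d ⊎ upper I a d ≡ lower I a
  upper-cases I a d = Sum.map x≤y⇒x⊔y≈y x≥y⇒x⊔y≈x (≤-total (lower I a) (stop I ⊓ d))

  upper-lower≤ : ∀ I a d → upper I a d - lower I a ≤ clamp I d - start I
  upper-lower≤ I a d with upper I a d | upper-cases I a d
  ... | _ | inj₁ refl = ≤-by (x≤y⊔x (start I) (stop I ⊓ d) ⊕ x≤x⊔y (start I) a)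
      (solve 4 (λ h l c s → h :- l :+ (c :+ l) := c :- s :+ (h :+ s)) refl (stop I ⊓ d) (lower I a) (clamp I d) (start I))
  ... | _ | inj₂ refl = ≤-by (start≤clamp I d)
      (solve 3 (λ l c s → l :- l :+ c := c :- s :+ s) refl (lower I a) (clamp I d) (start I))

  lower<upper : ∀ I a d → 0# < upper I a d - lower I a → start I < d × a < stop I
  lower<upper I a d 0<u-l with upper I a d | upper-cases I a d
  ... | _ | inj₁ refl = ≤-<-trans (x≤x⊔y (start I) a) (<-≤-trans l<u (x⊓y≤y (stop I) d)) ,
                 ≤-<-trans (x≤y⊔x (start I) a) (<-≤-trans l<u (x⊓y≤x (stop I) d))
    where
    l<u : lower I a < stop I ⊓ d
    l<u = <-by 0<u-l (solve 2 (λ l u → l :+ (u :- l) := u :+ ♯ 0) refl (lower I a) (stop I ⊓ d))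
  ... | _ | inj₂ refl = contradiction
    (subst (0# <_) (solve 1 (λ x → x :- x := ♯ 0) refl (lower I a)) 0<u-l) <-irrefl

  covers : ∀ I a d → a < d → d - a ≤ upper I a d - lower I a → start I ≤ a × d ≤ stop I
  covers I a d a<d d-a≤ with upper I a d | upper-cases I a d
  ... | _ | inj₁ refl =
    ≤-trans (x≤x⊔y (start I) a) (≤-by (d-a≤ ⊕ x⊓y≤y (stop I) d)
      (solve 4 (λ l a u d → l :+ (u :- l :+ d) := a :+ (d :- a :+ u)) refl (lower I a) a (stop I ⊓ d) d)) ,
    ≤-trans (≤-by (d-a≤ ⊕ x≤y⊔x (start I) a)
      (solve 4 (λ l a u d → d :+ (u :- l :+ l) := u :+ (d :- a :+ a)) refl (lower I a) a (stop I ⊓ d) d))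
      (x⊓y≤x (stop I) d)
  ... | _ | inj₂ refl = contradiction a<d (λ a<d → <⇒≱ a<d (≤-by d-a≤
      (solve 3 (λ l a d → d :+ (l :- l) := a :+ (d :- a)) refl (lower I a) a d)))

  δ-≤1 : ∀ x y → δ x y ≤ 1#
  δ-≤1 x y with Maybe.≡-dec _≟ⱼ_ x y
  ... | yes _ = ≤-refl
  ... | no  _ = <⇒≤ 0<1

  δ-refl : ∀ x → δ x x ≡ 1#
  δ-refl x with Maybe.≡-dec _≟ⱼ_ x x
  ... | yes _  = refl
  ... | no x≢x = contradiction refl x≢x

  δ-≢ : ∀ {x y} → x ≢ y → δ x y ≡ 0#
  δ-≢ {x} {y} x≢y with Maybe.≡-dec _≟ⱼ_ x y
  ... | yes x≡y = contradiction x≡y x≢y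
  ... | no  _   = refl

  δ-exclusive : ∀ {y z} x → y ≢ z → δ x y + δ x z ≤ 1#
  δ-exclusive {y} {z} x y≢z with Maybe.≡-dec _≟ⱼ_ x y
  ... | no  _    = subst (_≤ 1#) (sym (+-identityˡ _)) (δ-≤1 x z)
  ... | yes refl rewrite δ-≢ y≢z = ≤-reflexive (+-identityʳ 1#)

  pieces : ∀ {J} → Schedule J → List (ℕ × Interval)
  pieces S = concatMap (λ m → map (m ,_) (intervals S m)) (upTo (size S))

  ∈-pieces⁺ : ∀ {J} (S : Schedule J) {m I} → m ℕ.< size S → I ∈ intervals S m → (m , I) ∈ pieces S
  ∈-pieces⁺ S {m} m<size I∈ =
    ∈-concatMap⁺ (λ m → map (m ,_) (intervals S m)) (Any.map (λ { refl → ∈-map⁺ (m ,_) I∈ }) (∈-upTo⁺ m<size))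

  ∈-pieces⁻ : ∀ {J} (S : Schedule J) {m I} → (m , I) ∈ pieces S → I ∈ intervals S m
  ∈-pieces⁻ S mI∈ with Any.satisfied (∈-concatMap⁻ (λ m → map (m ,_) (intervals S m)) {xs = upTo (size S)} mI∈)
  ... | m , mI∈m with ∈-map⁻ (m ,_) mI∈m
  ...   | _ , I∈ , refl = I∈

  -- Some processor is on. Ranging over the finite list of pieces makes this decidable; the link
  -- with `On` is what lets `SameDecisions` transfer it between runs.
  Active : ∀ {J} → Schedule J → ℝ → Set
  Active S t = Any (λ mI → t ∈ᵢ proj₂ mI) (pieces S)

  active? : ∀ {J} (S : Schedule J) t → Dec (Active S t)
  active? S t = any? (λ (_ , I) → start I ≤? t ×-dec (t <? stop I)) (pieces S)
    where
    _<?_ : ∀ x y → Dec (x < y)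
    _<?_ x y with y ≤? x
    ... | yes y≤x = no λ x<y → <⇒≱ x<y y≤x
    ... | no  y≰x = yes (≰⇒> y≰x)

  Active⇒On : ∀ {J} (S : Schedule J) {t} → Active S t → ∃[ m ] On S m t
  Active⇒On S active = let (m , I) , mI∈ , t∈I = find active in m , lose (∈-pieces⁻ S mI∈) t∈I

  On⇒Active : ∀ {J} (S : Schedule J) {m t} → On S m t → Active S t
  On⇒Active S {m} {t} on with m ℕ.<? size S
  ... | yes m<size = let I , I∈ , t∈I = find on in lose (∈-pieces⁺ S m<size I∈) t∈I
  ... | no  m≮size = case subst (Any (t ∈ᵢ_)) (unused S m (ℕ.≮⇒≥ m≮size)) on of λ ()

  SameDecisions⇒Active : ∀ {t J J′} {S : Schedule J} {S′ : Schedule J′} →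
                         SameDecisions t S S′ → Active S t → Active S′ t
  SameDecisions⇒Active {S = S} {S′} same active = let m , on = Active⇒On S active in
    On⇒Active S′ (Equivalence.to (SameDecisions.same-on same m) on)

  SameDecisions⇒Active⁻ : ∀ {t J J′} {S : Schedule J} {S′ : Schedule J′} →
                          SameDecisions t S S′ → Active S′ t → Active S t
  SameDecisions⇒Active⁻ {S = S} {S′} same active = let m , on = Active⇒On S′ active in
    On⇒Active S (Equivalence.from (SameDecisions.same-on same m) on)

  processed : ∀ {J} → Schedule J → Job → ℕ → Interval → ℝ
  processed S j m I = ∫[_∩[_,_]] S I (arrival j) (deadline j) m (λ x → δ x (just j))

  lower≤upper : ∀ I a d → lower I a ≤ upper I a d
  lower≤upper I a d = x≤x⊔y (lower I a) _

  processed≤ : ∀ {J} (S : Schedule J) j m I →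
               processed S j m I ≤ upper I (arrival j) (deadline j) - lower I (arrival j)
  processed≤ S j m I = subst (processed S j m I ≤_) (*-identityˡ _)
    (HasIntegral-mono (proj₂ (measurable S m (λ x → δ x (just j)) _ _)) (HasIntegral-const 1#)
      (lower≤upper I (arrival j) (deadline j)) λ t _ _ → δ-≤1 (jobAt S m t) (just j))

  unitPower : Parameters
  unitPower = record
    { E-w = fromℕ 100 ; ψ-b = 1# ; ψ-σ = 1#
    ; E-w>0 = fromℕ-pos 99 ; ψ-σ>0 = 0<1 ; ψ-σ≤ψ-b = ≤-refl }

  power≡1 : ∀ x → power unitPower x ≡ 1#
  power≡1 x = solve 2 (λ o d → o :- d :* (o :- o) := o) refl 1# (δ x nothing)

  ∫power : ∀ {J} (S : Schedule J) m {a b} (0≤a : 0# ≤ a) (a≤b : a ≤ b) →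
           ∫ (measurable S m (power unitPower) 0≤a a≤b) ≡ b - a
  ∫power S m 0≤a a≤b = trans
    (HasIntegral-unique (proj₂ (measurable S m (power unitPower) 0≤a a≤b))
      (HasIntegral-cong (λ t _ _ → sym (power≡1 (jobAt S m t))) (HasIntegral-const 1#)) a≤b)
    (*-identityˡ _)

  switchCost : ℝ → Interval → ℝ
  switchCost t I = if does (start I ≤? t) then fromℕ 100 else 0#

  costOf : ℝ → ℕ × Interval → ℝ
  costOf t (_ , I) = switchCost t I + (clamp I t - start I)

  -- An integral-free form of the energy up to `t`: under `unitPower` busy and standby time both
  -- cost 1, so the integrals are lengths. It serves as a lower bound for `energyUpTo` of the
  -- algorithm and for `energy` of its competitors alike.
  cost : ∀ {J} → ℝ → Schedule J → ℝ
  cost t S = sum (map (costOf t) (pieces S))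

  switchCost-started : ∀ I {t} → start I ≤ t → switchCost t I ≡ fromℕ 100
  switchCost-started I {t} s≤t with start I ≤? t
  ... | yes _   = refl
  ... | no s≰t = contradiction s≤t s≰t

  switchCost-pending : ∀ I {t} → t < start I → switchCost t I ≡ 0#
  switchCost-pending I {t} t<s with start I ≤? t
  ... | yes s≤t = contradiction s≤t (<⇒≱ t<s)
  ... | no  _   = refl

  switchCost-nonNeg : ∀ t I → 0# ≤ switchCost t I
  switchCost-nonNeg t I with start I ≤? t
  ... | yes _ = fromℕ-nonNeg 100
  ... | no  _ = ≤-refl

  switchCost-≤ : ∀ t I → switchCost t I ≤ fromℕ 100
  switchCost-≤ t I with start I ≤? t
  ... | yes _ = ≤-refl
  ... | no  _ = fromℕ-nonNeg 100

  switchCost-mono : ∀ I {u v} → u ≤ v → switchCost u I ≤ switchCost v I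
  switchCost-mono I {u} {v} u≤v with start I ≤? u
  ... | yes s≤u rewrite switchCost-started I (≤-trans s≤u u≤v) = ≤-refl
  ... | no  _   = switchCost-nonNeg v I

  costOf-mono : ∀ {u v} → u ≤ v → ∀ mI → costOf u mI ≤ costOf v mI
  costOf-mono u≤v (m , I) = switchCost-mono I u≤v ⊕ +-monoˡ-≤ (- start I) (clamp-mono I u≤v)

  costOf-nonNeg : ∀ t mI → 0# ≤ costOf t mI
  costOf-nonNeg t (m , I) = subst (_≤ costOf t (m , I)) (+-identityˡ 0#) (switchCost-nonNeg t I ⊕ 0≤y-x (start≤clamp I t))

  cost-mono : ∀ {J} (S : Schedule J) {u v} → u ≤ v → cost u S ≤ cost v S
  cost-mono S u≤v = sum-mono (pieces S) (costOf-mono u≤v)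

  cost-nonNeg : ∀ {J} (S : Schedule J) t → 0# ≤ cost t S
  cost-nonNeg S t = subst (_≤ cost t S) (sum-zero (pieces S)) (sum-mono (pieces S) (costOf-nonNeg t))

  cost≡ : ∀ {J} (S : Schedule J) t →
          cost t S ≡ sum (map (λ m → sum (map (costOf t) (map (m ,_) (intervals S m)))) (upTo (size S)))
  cost≡ S t = sum-concatMap (costOf t) (λ m → map (m ,_) (intervals S m)) (upTo (size S))

  cost≤energyUpTo : ∀ {J} (S : Schedule J) t → cost t S ≤ energyUpTo unitPower t S
  cost≤energyUpTo S t = subst (_≤ energyUpTo unitPower t S) (sym (cost≡ S t))
    (sum-mono (upTo (size S)) λ m → go m (intervals S m))
    where
    integral : ℕ → Interval → ℝ
    integral m I = ∫[_∩[_,_]] S I 0# t m (power unitPower)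

    integrals : ℕ → List Interval → ℝ
    integrals m Is = sum (map (integral m) Is)

    rest : ℕ → List Interval → ℝ
    rest m Is = sum (map (costOf t) (map (m ,_) Is))

    started : List Interval → ℝ
    started Is = fromℕ (length (filter (λ I → start I ≤? t) Is))

    ∫≡ : ∀ m I → integral m I ≡ clamp I t - start I
    ∫≡ m I = trans (∫power S m _ (lower≤upper I 0# t))
      (cong (λ l → l ⊔ (stop I ⊓ t) - l) (x≥y⇒x⊔y≈x (start≥0 I)))

    go : ∀ m Is → rest m Is ≤ fromℕ 100 * started Is + integrals m Is
    go m [] = ≤-reflexive (solve 0 (♯ 0 := ♯ 100 :* ♯ 0 :+ ♯ 0) refl)
    go m (I ∷ Is) with start I ≤? t | go m Is
    ... | yes _ | ih = ≤-by (ih ⊕ ≤-reflexive (sym (∫≡ m I)) ⊕ ≤-reflexive (sym (*-identityʳ _)))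
      (solve 7 (λ o w c r n q p → w :+ c :+ r :+ (w :* n :+ q :+ p :+ w :* o) := w :* (o :+ n) :+ (p :+ q) :+ (r :+ c :+ w)) refl
        1# (fromℕ 100) (clamp I t - start I) (rest m Is) (started Is) (integrals m Is) (integral m I))
    ... | no _ | ih = ≤-by (ih ⊕ ≤-reflexive (sym (∫≡ m I)))
      (solve 6 (λ w c r n q p → ♯ 0 :+ c :+ r :+ (w :* n :+ q :+ p) := w :* n :+ (p :+ q) :+ (r :+ c)) refl
        (fromℕ 100) (clamp I t - start I) (rest m Is) (started Is) (integrals m Is) (integral m I))

  cost≤energy : ∀ {J} (S : Schedule J) t → cost t S ≤ energy unitPower S
  cost≤energy S t = subst (_≤ energy unitPower S) (sym (cost≡ S t))
    (sum-mono (upTo (size S)) λ m → go m (intervals S m))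
    where
    integral : ℕ → Interval → ℝ
    integral m I = ∫[_] S I m (power unitPower)

    integrals : ℕ → List Interval → ℝ
    integrals m Is = sum (map (integral m) Is)

    rest : ℕ → List Interval → ℝ
    rest m Is = sum (map (costOf t) (map (m ,_) Is))

    ∫≥ : ∀ m I → clamp I t - start I ≤ integral m I
    ∫≥ m I = subst (_ ≤_) (sym (∫power S m (start≥0 I) (<⇒≤ (start<stop I)))) (+-monoˡ-≤ (- start I) (clamp≤stop I t))

    go : ∀ m Is → rest m Is ≤ fromℕ 100 * fromℕ (length Is) + integrals m Is
    go m [] = ≤-reflexive (solve 0 (♯ 0 := ♯ 100 :* ♯ 0 :+ ♯ 0) refl)
    go m (I ∷ Is) = ≤-by (switchCost-≤ t I ⊕ ∫≥ m I ⊕ go m Is ⊕ ≤-reflexive (sym (*-identityʳ (fromℕ 100))))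
      (solve 8 (λ o k w c r n q p → k :+ c :+ r :+ (w :+ p :+ (w :* n :+ q) :+ w :* o) := w :* (o :+ n) :+ (p :+ q) :+ (k :+ c :+ r :+ w)) refl
        1# (switchCost t I) (fromℕ 100) (clamp I t - start I) (rest m Is) (fromℕ (length Is)) (integrals m Is) (integral m I) )

  ActiveOn : ∀ {J} → Schedule J → ℝ → ℝ → Set
  ActiveOn S u v = ∀ t → u ≤ t → t < v → Active S t

  -- Activity may pass from one piece to another and between processors, so the bound is pushed
  -- along the time axis by real induction instead of by following a single piece.
  cost-while-active : ∀ {J} (S : Schedule J) {u v} → u ≤ v → ActiveOn S u v → cost u S + (v - u) ≤ cost v S
  cost-while-active S {u} {v} u≤v active =
    realInduction (λ w → cost u S + (w - u) ≤ cost w S) u≤v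
      (≤-reflexive (solve 2 (λ c u → c :+ (u :- u) := c) refl (cost u S) u)) step limit
    where
    step : ∀ x → u ≤ x → x < v → cost u S + (x - u) ≤ cost x S →
           ¬ ¬ (∃[ y ] x < y × y ≤ v × cost u S + (y - u) ≤ cost y S)
    step x u≤x x<v ih none with find (active x u≤x x<v)
    -- The piece that is on at `x` stays on until its end, so up to `y` its own on-time already
    -- grows by `y - x`.
    ... | (m , I) , mI∈ , s≤x , x<e = none (y , x<y , x⊓y≤y (stop I) v ,
            ≤-by (ih ⊕ sum-mono-gain (costOf-mono (<⇒≤ x<y)) mI∈ gain)
              (solve 6 (λ c x y u cx cy → c :+ (y :- u) :+ (cx :+ cy) := cy :+ (c :+ (x :- u) :+ (cx :+ (y :- x)))) refl
                 (cost u S) x y u (cost x S) (cost y S)))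
      where
      y = stop I ⊓ v
      x<y : x < y
      x<y = ⊓-glb-< x<e x<v
      gain : costOf x (m , I) + (y - x) ≤ costOf y (m , I)
      gain rewrite clamp-inside I s≤x (<⇒≤ x<e) | clamp-inside I (≤-trans s≤x (<⇒≤ x<y)) (x⊓y≤x (stop I) v) =
        ≤-by (switchCost-mono I (<⇒≤ x<y))
          (solve 5 (λ c d x y s → c :+ (x :- s) :+ (y :- x) :+ d := d :+ (y :- s) :+ c) refl
            (switchCost x I) (switchCost y I) x y (start I))

    limit : ∀ x → u ≤ x → x ≤ v →
            (∀ y → y < x → ¬ ¬ (∃[ z ] y < z × u ≤ z × z ≤ x × cost u S + (z - u) ≤ cost z S)) →
            cost u S + (x - u) ≤ cost x S
    -- Since `cost` is monotone, moving from `z` to `x` loses less than `ε`; the other two copies of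
    -- `ε` are padding.
    limit x _ _ near = ≤-limit λ ε 0<ε none → near (x - ε) (x-y<x 0<ε) λ (z , x-ε<z , _ , z≤x , ih) → none
      (<-by (ih ⊕ cost-mono S z≤x ⊕ <⇒≤ 0<ε ⊕ <⇒≤ 0<ε ⊕< x-ε<z)
        (solve 7 (λ c x u e z cz cx → c :+ (x :- u) :+ (cz :+ cx :+ e :+ e :+ z)
            := cx :+ (e :+ e :+ e) :+ (c :+ (z :- u) :+ cz :+ ♯ 0 :+ ♯ 0 :+ (x :- e))) refl
          (cost u S) x u ε z (cost z S) (cost x S)))

  -- With `P` as disjointness, irreflexivity rules out a second occurrence of `x` in the list, so
  -- its positive term is counted only once.
  sum-sole : ∀ {A : Set} {P : A → A → Set} {f : A → ℝ} {x} xs → AllPairs P xs → ¬ P x x →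
             (∀ {y} → y ∈ xs → f y ≤ 0# ⊎ y ≡ x) → sum (map f xs) ≤ 0# ⊎ (x ∈ xs × sum (map f xs) ≤ f x)
  sum-sole [] _ _ _ = inj₁ ≤-refl
  sum-sole {f = f} {x} (y ∷ ys) (Py ∷ Pys) ¬Pxx sole with sole (here refl) | sum-sole ys Pys ¬Pxx (sole ∘ there)
  ... | inj₁ fy≤0 | inj₁ s≤0 = inj₁ (subst (f y + sum (map f ys) ≤_) (+-identityˡ 0#) (fy≤0 ⊕ s≤0))
  ... | inj₁ fy≤0 | inj₂ (x∈ys , s≤fx) =
    inj₂ (there x∈ys , subst (f y + sum (map f ys) ≤_) (+-identityˡ (f x)) (fy≤0 ⊕ s≤fx))
  ... | inj₂ refl | inj₁ s≤0 =
    inj₂ (here refl , subst (f y + sum (map f ys) ≤_) (+-identityʳ (f y)) (≤-refl ⊕ s≤0))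
  ... | inj₂ refl | inj₂ (x∈ys , _) = contradiction (All.lookup Py x∈ys) ¬Pxx

  ¬Disjoint-self : ∀ I → ¬ Disjoint I I
  ¬Disjoint-self I disjoint = disjoint (start I) (inside , inside)
    where inside = ≤-refl , start<stop I

  overlaps : ∀ {J} (S : Schedule J) → Feasible S → ∀ {j} → j ∈ jobs J → 0# < exec j →
             ∃[ mI ] mI ∈ pieces S × start (proj₂ mI) < deadline j × arrival j < stop (proj₂ mI)
  overlaps S feasible {j} j∈J 0<c with feasible j j∈J
  ... | m , m<size , c≤ with sum-pos {f = processed S j m} (intervals S m) (<-≤-trans 0<c c≤)
  ...   | I , I∈ , 0<p = (m , I) , ∈-pieces⁺ S m<size I∈ ,
            lower<upper I (arrival j) (deadline j) (<-≤-trans 0<p (processed≤ S j m I))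

  -- A piece that works on `j` ends after `u`. Had it started by `u`, it would be on at `u`; so its
  -- switch-on falls after `u` and before the deadline.
  cost-after-idle : ∀ {J} (S : Schedule J) → Feasible S → ∀ {u j} → ¬ Active S u → u < arrival j →
                    j ∈ jobs J → 0# < exec j → u ≤ deadline j → cost u S + fromℕ 100 ≤ cost (deadline j) S
  cost-after-idle S feasible {u} {j} idle u<a j∈J 0<c u≤d = charge (overlaps S feasible j∈J 0<c)
    where
    charge : ∃[ mI ] (mI ∈ pieces S × start (proj₂ mI) < deadline j × arrival j < stop (proj₂ mI)) →
             cost u S + fromℕ 100 ≤ cost (deadline j) S
    charge ((m , I) , mI∈ , s<d , a<e) = sum-mono-gain (costOf-mono u≤d) mI∈
      (≤-by (≤-reflexive (switchCost-pending I u<s) ⊕ ≤-reflexive (sym (switchCost-started I (<⇒≤ s<d))) ⊕ clamp-mono I u≤d)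
        (solve 6 (λ w k l c d s → k :+ (c :- s) :+ w :+ (♯ 0 :+ l :+ d) := l :+ (d :- s) :+ (k :+ w :+ c)) refl
          (fromℕ 100) (switchCost u I) (switchCost (deadline j) I) (clamp I u) (clamp I (deadline j)) (start I)))
      where
      u<s : u < start I
      u<s = ≰⇒> λ s≤u → idle (lose mI∈ (s≤u , ≤-<-trans (<⇒≤ u<a) a<e))

  cost-active : ∀ {J} (S : Schedule J) {t} → Active S t → fromℕ 100 ≤ cost t S
  cost-active S {t} active =
    let (m , I) , mI∈ , s≤t , _ = find active in ≤-trans
      (≤-by (0≤y-x (start≤clamp I t) ⊕ ≤-reflexive (sym (switchCost-started I s≤t)))
        (solve 3 (λ w c k → w :+ (c :+ k) := k :+ c :+ (♯ 0 :+ w)) refl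
           (fromℕ 100) (clamp I t - start I) (switchCost t I)))
      (sum-∈ {f = costOf t} (costOf-nonNeg t) mI∈)

  started : ∀ {J} → ℝ → Schedule J → List (ℕ × Interval)
  started t S = filter (λ mI → start (proj₂ mI) ≤? t) (pieces S)

  onTime : ℝ → ℕ × Interval → ℝ
  onTime t (_ , I) = clamp I t - start I

  sum-nonNeg : ∀ {A : Set} {f : A → ℝ} xs → (∀ x → 0# ≤ f x) → 0# ≤ sum (map f xs)
  sum-nonNeg {f = f} xs 0≤f = subst (_≤ sum (map f xs)) (sum-zero xs) (sum-mono xs 0≤f)

  exec≤onTime : ∀ {J} (S : Schedule J) → Feasible S → ∀ {j t} → j ∈ jobs J → deadline j ≤ t →
                exec j ≤ sum (map (onTime t) (pieces S))
  exec≤onTime S feasible {j} {t} j∈J d≤t with feasible j j∈J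
  ... | m , m<size , c≤ = begin
    exec j                                             ≤⟨ c≤ ⟩
    sum (map (processed S j m) (intervals S m))        ≤⟨ sum-mono (intervals S m) processed≤onTime ⟩
    sum (map (onTime t ∘ (m ,_)) (intervals S m))      ≡⟨ cong sum (map-∘ (intervals S m)) ⟩
    onProcessor m                                      ≤⟨ sum-∈ {f = onProcessor} onProcessor-nonNeg (∈-upTo⁺ m<size) ⟩
    sum (map onProcessor (upTo (size S)))              ≡⟨ sum-concatMap (onTime t) (λ m → map (m ,_) (intervals S m)) (upTo (size S)) ⟨
    sum (map (onTime t) (pieces S))                    ∎
    where
    open PartialOrderReasoning (DecTotalOrder.poset decTotalOrder) hiding (start; stop)

    onProcessor : ℕ → ℝ
    onProcessor m = sum (map (onTime t) (map (m ,_) (intervals S m)))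

    onProcessor-nonNeg : ∀ m → 0# ≤ onProcessor m
    onProcessor-nonNeg m = sum-nonNeg (map (m ,_) (intervals S m)) λ (_ , I) → 0≤y-x (start≤clamp I t)

    processed≤onTime : ∀ I → processed S j m I ≤ onTime t (m , I)
    processed≤onTime I = ≤-trans (processed≤ S j m I) (≤-trans
      (upper-lower≤ I (arrival j) (deadline j)) (+-monoˡ-≤ (- start I) (clamp-mono I d≤t)))

  cost-started : ∀ {J} (S : Schedule J) t →
    fromℕ 100 * fromℕ (length (started t S)) + sum (map (onTime t) (pieces S)) ≡ cost t S
  cost-started S t = go (pieces S)
    where
    count : List (ℕ × Interval) → ℝ
    count xs = fromℕ (length (filter (λ mI → start (proj₂ mI) ≤? t) xs))

    go : ∀ xs → fromℕ 100 * count xs + sum (map (onTime t) xs) ≡ sum (map (costOf t) xs)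
    go [] = solve 0 (♯ 100 :* ♯ 0 :+ ♯ 0 := ♯ 0) refl
    go (mI ∷ xs) with start (proj₂ mI) ≤? t | go xs
    ... | no _  | ih = trans
      (solve 4 (λ w n c s → w :* n :+ (c :+ s) := ♯ 0 :+ c :+ (w :* n :+ s)) refl
        (fromℕ 100) (count xs) (onTime t mI) (sum (map (onTime t) xs)))
      (cong (0# + onTime t mI +_) ih)
    ... | yes _ | ih = trans
      (solve 5 (λ o w n c s → w :* (o :+ n) :+ (c :+ s) := w :* o :+ c :+ (w :* n :+ s)) refl
        1# (fromℕ 100) (count xs) (onTime t mI) (sum (map (onTime t) xs)))
      (cong₂ (λ w s → w + onTime t mI + s) (*-identityʳ (fromℕ 100)) ih)

  cost-two-started : ∀ {J} (S : Schedule J) t {x y zs} → started t S ≡ x ∷ y ∷ zs →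
                     fromℕ 200 + sum (map (onTime t) (pieces S)) ≤ cost t S
  cost-two-started S t {zs = zs} eq =
    subst (fromℕ 200 + on ≤_) (trans (cong (λ xs → fromℕ 100 * fromℕ (length xs) + on) (sym eq)) (cost-started S t))
      (≤-by (100 ⊗ fromℕ-nonNeg (length zs) ⊕ ≤-reflexive (sym (*-identityʳ (fromℕ 200))))
        (solve 3 (λ o n s → ♯ 200 :+ s :+ (♯ 100 :* n :+ ♯ 200 :* o)
                    := ♯ 100 :* (o :+ (o :+ n)) :+ s :+ (♯ 100 :* ♯ 0 :+ ♯ 200)) refl 1# (fromℕ (length zs)) on))
    where on = sum (map (onTime t) (pieces S))

  -- Pieces that start after `t` miss the window of `j` altogether, so all of its work falls on `I`.
  sole-piece : ∀ {J} (S : Schedule J) → Feasible S → ∀ {t m I j} → started t S ≡ (m , I) ∷ [] →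
               j ∈ jobs J → 0# < exec j → deadline j ≤ t → exec j ≤ processed S j m I
  sole-piece S feasible {t} {m} {I} {j} eq j∈J 0<c d≤t with feasible j j∈J
  ... | m′ , m′<size , c≤ with sum-sole {f = processed S j m′} (intervals S m′) (disjoint S m′) (¬Disjoint-self I) sole
    where
    sole : ∀ {I′} → I′ ∈ intervals S m′ → processed S j m′ I′ ≤ 0# ⊎ I′ ≡ I
    sole {I′} I′∈ with start I′ ≤? t
    ... | no s≰t = inj₁ (≮⇒≥ λ 0<p → s≰t (≤-trans (<⇒≤ (proj₁
            (lower<upper I′ (arrival j) (deadline j) (<-≤-trans 0<p (processed≤ S j m′ I′))))) d≤t))
    ... | yes s≤t with subst ((m′ , I′) ∈_) eq (∈-filter⁺ (λ mI → start (proj₂ mI) ≤? t) (∈-pieces⁺ S m′<size I′∈) s≤t)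
    ...   | here refl = inj₂ refl
  ... | inj₁ s≤0 = contradiction (<-≤-trans 0<c (≤-trans c≤ s≤0)) <-irrefl
  ... | inj₂ (I∈ , s≤p) with subst ((m′ , I) ∈_) eq (∈-filter⁺ (λ mI → start (proj₂ mI) ≤? t) (∈-pieces⁺ S m′<size I∈)
          (proj₂ (∈-filter⁻ (λ mI → start (proj₂ mI) ≤? t) {xs = pieces S} (subst ((m , I) ∈_) (sym eq) (here refl)))))
  ...   | here refl = ≤-trans c≤ s≤p

-- The adversary's job sets and their optimal single-processor schedules.

module SingleProcessor (R : Reals) where
  open Scheduling R
  open RealProperties R
  open IntegralProperties R
  open ScheduleProperties R
  open MaxOperator maxOperator using (x≤y⇒x⊔y≈y; x≥y⇒x⊔y≈x)

  upper-inside : ∀ I a {d} → lower I a ≤ d → d ≤ stop I → upper I a d ≡ d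
  upper-inside I a {d} l≤d d≤e = trans
    (cong (lower I a ⊔_) (≤-antisym (x⊓y≤y (stop I) d) (⊓-glb-≤ d≤e ≤-refl))) (x≤y⇒x⊔y≈y l≤d)

  -- Cut at `arrival j′`: before it `j` gets at most the elapsed time, and after it the two
  -- indicators add up to at most 1 at every instant.
  processed-exclusive : ∀ {J} (S : Schedule J) m I {j j′ d} → j ≢ j′ → arrival j ≤ start I →
    start I ≤ arrival j′ → arrival j′ ≤ d → d ≤ stop I → deadline j ≡ d → deadline j′ ≡ d →
    processed S j m I + processed S j′ m I ≤ d - start I
  processed-exclusive S m I {j} {j′} {d} j≢j′ a≤s s≤a′ a′≤d d≤e refl d′≡d = ≤-by
    (≤-reflexive (HasIntegral-split s≤a′ a′≤d whole (proj₂ left) (proj₂ right))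
      ⊕ HasIntegral-mono (proj₂ left) (HasIntegral-const 1#) s≤a′ (λ t _ _ → δ-≤1 (jobAt S m t) (just j))
      ⊕ HasIntegral-mono (HasIntegral-+ (proj₂ right) tail) (HasIntegral-const 1#) a′≤d
          (λ t _ _ → δ-exclusive (jobAt S m t) λ { refl → j≢j′ refl })
      ⊕ ≤-reflexive (*-identityˡ (arrival j′ - start I)) ⊕ ≤-reflexive (*-identityˡ (d - arrival j′)))
    (solve 9 (λ p p′ v w d s a x y → p :+ p′ :+ (v :+ w :+ x :+ y :+ (a :- s) :+ (d :- a))
                := d :- s :+ (p :+ v :+ (w :+ p′) :+ x :+ y)) refl
      (processed S j m I) (processed S j′ m I) (proj₁ left) (proj₁ right) d (start I) (arrival j′)
      (1# * (arrival j′ - start I)) (1# * (d - arrival j′)))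
    where
    f f′ : Maybe Job → ℝ
    f  x = δ x (just j)
    f′ x = δ x (just j′)

    left : Integrable (f ∘ jobAt S m) (start I) (arrival j′)
    left = measurable S m f (start≥0 I) s≤a′

    right : Integrable (f ∘ jobAt S m) (arrival j′) d
    right = measurable S m f (≤-trans (start≥0 I) s≤a′) a′≤d

    integral : ∀ i {l u} → deadline i ≡ d → lower I (arrival i) ≡ l → upper I (arrival i) d ≡ u →
               HasIntegral (λ t → δ (jobAt S m t) (just i)) l u (processed S i m I)
    integral i refl refl refl = proj₂ (measurable S m (λ x → δ x (just i)) _ _)

    lower≡ : lower I (arrival j) ≡ start I
    lower≡ = x≥y⇒x⊔y≈x a≤s

    lower′≡ : lower I (arrival j′) ≡ arrival j′
    lower′≡ = x≤y⇒x⊔y≈y s≤a′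

    whole : HasIntegral (f ∘ jobAt S m) (start I) d (processed S j m I)
    whole = integral j refl lower≡
      (upper-inside I (arrival j) (subst (_≤ d) (sym lower≡) (≤-trans s≤a′ a′≤d)) d≤e)

    tail : HasIntegral (f′ ∘ jobAt S m) (arrival j′) d (processed S j′ m I)
    tail = integral j′ d′≡d lower′≡
      (upper-inside I (arrival j′) (subst (_≤ d) (sym lower′≡) a′≤d) d≤e)

  -- Lists are kept with the latest arrival first, so the first job that has arrived is the most
  -- recent one.
  latest : List Job → ℝ → Maybe Job
  latest []       t = nothing
  latest (j ∷ js) t = if does (arrival j ≤? t) then just j else latest js t

  latest-arrived : ∀ {j} js {t} → arrival j ≤ t → latest (j ∷ js) t ≡ just j
  latest-arrived {j} js {t} a≤t with arrival j ≤? t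
  ... | yes _   = refl
  ... | no a≰t = contradiction a≤t a≰t

  latest-pending : ∀ {j} js {t} → t < arrival j → latest (j ∷ js) t ≡ latest js t
  latest-pending {j} js {t} t<a with arrival j ≤? t
  ... | yes a≤t = contradiction a≤t (<⇒≱ t<a)
  ... | no  _   = refl

  latest-∈ : ∀ js t {j} → latest js t ≡ just j → j ∈ js
  latest-∈ (j ∷ js) t eq with arrival j ≤? t
  latest-∈ (j ∷ js) t refl | yes _ = here refl
  ... | no _ = there (latest-∈ js t eq)

  Descending : List Job → Set
  Descending = AllPairs (λ j j′ → arrival j′ ≤ arrival j)

  head : List Job → Maybe Job
  head []      = nothing
  head (j ∷ _) = just j

  latest-final : ∀ js {u t} → All (λ j → arrival j ≤ u) js → u ≤ t → latest js t ≡ head js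
  latest-final []       []        u≤t = refl
  latest-final (j ∷ js) (a≤u ∷ _) u≤t = latest-arrived js (≤-trans a≤u u≤t)

  -- When `j` arrives, all jobs of `js` have arrived and `latest js` rests at its head, which is the
  -- constancy that `Integrable-override` asks for.
  Integrable-latest : ∀ (g : Maybe Job → ℝ) js {a b} → Descending js → Integrable (g ∘ latest js) a b
  Integrable-latest g []       []             = _ , HasIntegral-const (g nothing)
  Integrable-latest g (j ∷ js) (js≤j ∷ desc) =
    _ , HasIntegral-cong (λ t _ _ → eq t) (proj₂ (Integrable-override (arrival j) (g (just j)) (g (head js))
          (λ t a≤t → cong g (latest-final js js≤j a≤t)) (Integrable-latest g js desc)))
    where
    eq : ∀ t → (if does (arrival j ≤? t) then g (just j) else g (latest js t)) ≡ g (latest (j ∷ js) t)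
    eq t with arrival j ≤? t
    ... | yes _ = refl
    ... | no  _ = refl

  urgent : ℝ → ℝ → Job
  urgent a d = job a d (d - a)

  urgent-wellFormed : ∀ {a d} → 0# ≤ a → a ≤ d → WellFormed (urgent a d)
  urgent-wellFormed {a} {d} 0≤a a≤d = record
    { arrival≥0 = 0≤a
    ; exec≥0    = 0≤y-x a≤d
    ; fits      = ≤-reflexive (solve 2 (λ a d → a :+ (d :- a) := d) refl a d)
    }

  horizon : ℝ
  horizon = fromℕ 51

  flex : Job
  flex = job 0# horizon (fromℕ 1)

  0<horizon : 0# < horizon
  0<horizon = fromℕ-pos 50

  flex-wellFormed : WellFormed flex
  flex-wellFormed = record
    { arrival≥0 = ≤-refl
    ; exec≥0    = fromℕ-nonNeg 1
    ; fits      = ≤-by (fromℕ-nonNeg 50) (solve 0 (♯ 0 :+ ♯ 1 :+ ♯ 50 := ♯ 51 :+ ♯ 0) refl)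
    }

  -- The release time `r` of the second job is left open: it is 1 against an algorithm that is off
  -- at time 0 and 50 against one that is on. The bound `1≤r` leaves room for `flex` just before it.
  module Chains (r : ℝ) (1≤r : fromℕ 1 ≤ r) (r<horizon : r < horizon) where

    tight : Job
    tight = urgent r horizon

    -- The real index is the last deadline.
    data Chain : List Job → ℝ → Set where
      base   : Chain (tight ∷ flex ∷ []) horizon
      strike : ∀ {js e t} → Chain js e → e < t → Chain (urgent t (t + fromℕ 1) ∷ js) (t + fromℕ 1)

    0≤r : 0# ≤ r
    0≤r = ≤-trans (fromℕ-nonNeg 1) 1≤r

    0<r : 0# < r
    0<r = <-≤-trans (fromℕ-pos 0) 1≤r

    horizon≤end : ∀ {js e} → Chain js e → horizon ≤ e
    horizon≤end base           = ≤-refl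
    horizon≤end (strike ch e<t) =
      ≤-trans (horizon≤end ch) (≤-trans (<⇒≤ e<t) (<⇒≤ (x<x+y (fromℕ-pos 0))))

    tight-∈ : ∀ {js e} → Chain js e → tight ∈ js
    tight-∈ base          = here refl
    tight-∈ (strike ch _) = there (tight-∈ ch)

    flex-∈ : ∀ {js e} → Chain js e → flex ∈ js
    flex-∈ base          = there (here refl)
    flex-∈ (strike ch _) = there (flex-∈ ch)

    deadline≤end : ∀ {js e j} → Chain js e → j ∈ js → deadline j ≤ e
    deadline≤end base (here refl)         = ≤-refl
    deadline≤end base (there (here refl)) = ≤-refl
    deadline≤end (strike ch _) (here refl) = ≤-refl
    deadline≤end (strike ch e<t) (there j∈) =
      ≤-trans (deadline≤end ch j∈) (≤-trans (<⇒≤ e<t) (<⇒≤ (x<x+y (fromℕ-pos 0))))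

    arrival≤end : ∀ {js e j} → Chain js e → j ∈ js → arrival j ≤ e
    arrival≤end base (here refl)         = <⇒≤ r<horizon
    arrival≤end base (there (here refl)) = <⇒≤ 0<horizon
    arrival≤end (strike ch _) (here refl) = <⇒≤ (x<x+y (fromℕ-pos 0))
    arrival≤end (strike ch e<t) (there j∈) =
      ≤-trans (arrival≤end ch j∈) (≤-trans (<⇒≤ e<t) (<⇒≤ (x<x+y (fromℕ-pos 0))))

    descending : ∀ {js e} → Chain js e → Descending js
    descending base            = (0≤r ∷ []) ∷ [] ∷ []
    descending (strike ch e<t) =
      All.tabulate (λ j∈ → ≤-trans (arrival≤end ch j∈) (<⇒≤ e<t)) ∷ descending ch

    jobSet : ∀ {js e} → Chain js e → JobSet
    jobSet {js} ch = record { jobs = js ; unique = distinct ch ; wellFormed = fit ch }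
      where
      distinct : ∀ {js e} → Chain js e → AllPairs _≢_ js
      distinct base = ((λ tight≡flex → proj₂ 0<r (sym (cong arrival tight≡flex))) ∷ []) ∷ [] ∷ []
      distinct (strike ch e<t) =
        All.tabulate (λ j∈ → λ { refl → <⇒≱ e<t (arrival≤end ch j∈) }) ∷ distinct ch

      fit : ∀ {js e} → Chain js e → All WellFormed js
      fit base            = urgent-wellFormed 0≤r (<⇒≤ r<horizon) ∷ flex-wellFormed ∷ []
      fit (strike {t = t} ch e<t) = urgent-wellFormed
        (≤-trans (<⇒≤ 0<horizon) (≤-trans (horizon≤end ch) (<⇒≤ e<t))) (<⇒≤ (x<x+y (fromℕ-pos 0))) ∷ fit ch

    lastUrgent : ∀ {js e} → Chain js e → ∃[ a ] urgent a e ∈ js × a < e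
    lastUrgent base         = r , here refl , r<horizon
    lastUrgent (strike _ _) = _ , here refl , x<x+y (fromℕ-pos 0)

    -- An urgent job holds the processor on its closed window, deadline included. The strict gap
    -- between consecutive jobs of a chain provides this.
    data View (js : List Job) : Job → Set where
      isFlex   : View js flex
      isUrgent : ∀ {a d} → r ≤ a → a ≤ d → (∀ t → a ≤ t → t ≤ d → latest js t ≡ just (urgent a d)) →
                 View js (urgent a d)

    view : ∀ {js e j} → Chain js e → j ∈ js → View js j
    view base (here refl) = isUrgent ≤-refl (<⇒≤ r<horizon) λ t r≤t _ → latest-arrived (flex ∷ []) r≤t
    view base (there (here refl)) = isFlex
    view (strike {js} ch e<t) (here refl) = isUrgent
      (≤-trans (<⇒≤ r<horizon) (≤-trans (horizon≤end ch) (<⇒≤ e<t))) (<⇒≤ (x<x+y (fromℕ-pos 0)))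
      λ t a≤t _ → latest-arrived js a≤t
    view (strike {js} ch e<t) (there j∈) with view ch j∈ | deadline≤end ch j∈
    ... | isFlex | _ = isFlex
    ... | isUrgent r≤a a≤d latest≡ | d≤e = isUrgent r≤a a≤d λ t a≤t t≤d →
      trans (latest-pending js (≤-<-trans t≤d (≤-<-trans d≤e e<t))) (latest≡ t a≤t t≤d)

    -- Up to `horizon` the indicator of `flex` is the complement of a step at `r`, so its integral
    -- follows from that of the step.
    latest-flex : ∀ {js e} → Chain js e → ∀ t → 0# ≤ t → t ≤ horizon →
                  δ (latest js t) (just flex) + heaviside r t ≡ 1#
    latest-flex (strike {js} ch e<t′) t 0≤t t≤h =
      trans (cong (λ x → δ x (just flex) + heaviside r t)
              (latest-pending js (≤-<-trans t≤h (≤-<-trans (horizon≤end ch) e<t′))))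
            (latest-flex ch t 0≤t t≤h)
    latest-flex base t 0≤t t≤h = go (r ≤? t)
      where
      go : Dec (r ≤ t) → δ (latest (tight ∷ flex ∷ []) t) (just flex) + heaviside r t ≡ 1#
      go (yes r≤t) = trans (cong₂ _+_
        (trans (cong (λ x → δ x (just flex)) (latest-arrived (flex ∷ []) r≤t))
               (δ-≢ λ eq → proj₂ 0<r (sym (cong arrival (Maybe.just-injective eq)))))
        (heaviside-1 r≤t)) (+-identityˡ 1#)
      go (no r≰t) = trans (cong₂ _+_
        (trans (cong (λ x → δ x (just flex)) (trans (latest-pending (flex ∷ []) (≰⇒> r≰t)) (latest-arrived [] 0≤t)))
               (δ-refl (just flex)))
        (heaviside-0 (≰⇒> r≰t))) (+-identityʳ 1#)

    opt : ℝ → ℝ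
    opt e = fromℕ 100 + (e - (r - fromℕ 1))

    r-1≤r : r - fromℕ 1 ≤ r
    r-1≤r = <⇒≤ (x-y<x (fromℕ-pos 0))

    -- A sole interval executes both flex and tight before the horizon, and
    -- tight leaves no room for flex after r.
    dichotomy : ∀ {js e} → Chain js e → ∀ {K} (S : Schedule K) → Feasible S → (∀ {j} → j ∈ js → j ∈ jobs K) →
                fromℕ 200 + (horizon - r) ≤ cost e S ⊎
                ∃[ mI ] mI ∈ pieces S × start (proj₂ mI) ≤ r - fromℕ 1 × e ≤ stop (proj₂ mI)
    dichotomy {js} {e} ch S feasible js⊆K = go (started e S) refl
      where
      tight-∈K = js⊆K (tight-∈ ch)

      go : ∀ xs → started e S ≡ xs → fromℕ 200 + (horizon - r) ≤ cost e S ⊎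
           ∃[ mI ] mI ∈ pieces S × start (proj₂ mI) ≤ r - fromℕ 1 × e ≤ stop (proj₂ mI)
      go [] eq =
        let mI , mI∈ , s<h , _ = overlaps S feasible tight-∈K (0<y-x r<horizon)
        in case subst (mI ∈_) eq (∈-filter⁺ (λ mI → start (proj₂ mI) ≤? e) mI∈
                 (≤-trans (<⇒≤ s<h) (horizon≤end ch))) of λ ()
      -- Two switch-ons, plus the on-time that `tight` alone requires.
      go (x ∷ y ∷ zs) eq = inj₁ (≤-trans
        (≤-refl ⊕ exec≤onTime S feasible tight-∈K (horizon≤end ch)) (cost-two-started S e eq))
      go ((m , I) ∷ []) eq = inj₂ ((m , I) ,
        proj₁ (∈-filter⁻ (λ mI → start (proj₂ mI) ≤? e) {xs = pieces S} (subst ((m , I) ∈_) (sym eq) (here refl))) ,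
        -- The urgent job with deadline `e` has no slack, so the sole interval must last until `e`.
        start≤ , proj₂ (covered (proj₁ (proj₂ (lastUrgent ch))) ≤-refl (proj₂ (proj₂ (lastUrgent ch)))))
        where
        covered : ∀ {a d} → urgent a d ∈ js → d ≤ e → a < d → start I ≤ a × d ≤ stop I
        covered {a} {d} j∈ d≤e a<d = covers I a d a<d (≤-trans
          (sole-piece S feasible eq (js⊆K j∈) (0<y-x a<d) d≤e) (processed≤ S (urgent a d) m I))

        start≤ : start I ≤ r - fromℕ 1
        start≤ = let s≤r , h≤e = covered (tight-∈ ch) (horizon≤end ch) r<horizon in ≤-by
          (sole-piece S feasible eq (js⊆K (flex-∈ ch)) (fromℕ-pos 0) (horizon≤end ch)
            ⊕ sole-piece S feasible eq tight-∈K (0<y-x r<horizon) (horizon≤end ch)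
            ⊕ processed-exclusive S m I {flex} {tight} (λ flex≡tight → proj₂ 0<r (cong arrival flex≡tight))
                (start≥0 I) s≤r (<⇒≤ r<horizon) h≤e refl refl)
          (solve 5 (λ s h r p q → s :+ (p :+ q :+ (h :- s)) := r :- ♯ 1 :+ (♯ 1 :+ (h :- r) :+ (p :+ q))) refl
            (start I) horizon r (processed S flex m I) (processed S tight m I))

    -- flex runs during [ r - 1 , r ), and every other job from its arrival until the
    -- next one; standby is not modelled since it costs as much as being busy.
    module Merged {js e} (ch : Chain js e) (K : JobSet) (K≈js : ∀ {j} → j ∈ jobs K ⇔ j ∈ js) where

      window : Interval
      window = record
        { start = r - fromℕ 1
        ; stop  = e
        ; start≥0 = 0≤y-x 1≤r
        ; start<stop = ≤-<-trans r-1≤r (<-≤-trans r<horizon (horizon≤end ch))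
        }

      merged : Schedule K
      merged = record
        { size       = 1
        ; intervals  = λ { zero → window ∷ [] ; (suc _) → [] }
        ; disjoint   = λ { zero → [] ∷ [] ; (suc _) → [] }
        ; unused     = λ { (suc _) _ → refl ; zero () }
        ; jobAt      = λ _ → latest js
        ; jobAt∈J    = λ _ t eq → Equivalence.from K≈js (latest-∈ js t eq)
        ; measurable = λ _ g _ _ → Integrable-latest g js (descending ch)
        }

      energy-merged : energy unitPower merged ≡ opt e
      energy-merged = trans
        (cong (λ x → fromℕ 100 * fromℕ 1 + (x + 0#) + 0#) (∫power merged 0 (start≥0 window) (<⇒≤ (start<stop window))))
        (solve 2 (λ e r → ♯ 100 :* ♯ 1 :+ (e :- (r :- ♯ 1) :+ ♯ 0) :+ ♯ 0 := ♯ 100 :+ (e :- (r :- ♯ 1))) refl e r)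

      exec≤processed : ∀ {j} → j ∈ js → exec j ≤ processed merged j 0 window
      exec≤processed {j} j∈ with view ch j∈ | deadline≤end ch j∈
      ... | isUrgent {a} {d} r≤a a≤d latest≡ | d≤e = HasIntegral-mono (HasIntegral-const′ a d)
              integral a≤d λ t a≤t t≤d → ≤-reflexive (sym (trans (cong (λ x → δ x (just j)) (latest≡ t a≤t t≤d)) (δ-refl (just j))))
        where
        lower≡ : lower window a ≡ a
        lower≡ = x≤y⇒x⊔y≈y (≤-trans r-1≤r r≤a)
        integral : HasIntegral (λ t → δ (latest js t) (just j)) a d (processed merged j 0 window)
        integral = subst₂ (λ l u → HasIntegral _ l u (processed merged j 0 window)) lower≡
          (upper-inside window a (subst (_≤ d) (sym lower≡) a≤d) d≤e)
          (proj₂ (measurable merged 0 (λ x → δ x (just j))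
            (≤-trans (start≥0 window) (x≤x⊔y (start window) a)) (lower≤upper window a d)))
        HasIntegral-const′ : ∀ a d → HasIntegral (λ _ → 1#) a d (d - a)
        HasIntegral-const′ a d = subst (HasIntegral _ a d) (*-identityˡ _) (HasIntegral-const 1#)
      ... | isFlex | h≤e = ≤-by (≤-reflexive (sym (trans (HasIntegral-unique
              (HasIntegral-+ integral (HasIntegral-heaviside r-1≤r (<⇒≤ r<horizon)))
              (HasIntegral-cong (λ t s≤t t≤h → sym (latest-flex ch t (≤-trans (start≥0 window) s≤t) t≤h)) (HasIntegral-const 1#))
              (≤-trans r-1≤r (<⇒≤ r<horizon))) (*-identityˡ _))))
            (solve 3 (λ p h r → ♯ 1 :+ (p :+ (h :- r)) := p :+ (h :- (r :- ♯ 1))) refl (processed merged flex 0 window) horizon r)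
        where
        lower≡ : lower window 0# ≡ r - fromℕ 1
        lower≡ = x≥y⇒x⊔y≈x (start≥0 window)
        integral : HasIntegral (λ t → δ (latest js t) (just flex)) (r - fromℕ 1) horizon (processed merged flex 0 window)
        integral = subst₂ (λ l u → HasIntegral _ l u (processed merged flex 0 window)) lower≡
          (upper-inside window 0# (subst (_≤ horizon) (sym lower≡) (≤-trans r-1≤r (<⇒≤ r<horizon))) h≤e)
          (proj₂ (measurable merged 0 (λ x → δ x (just flex))
            (≤-trans (start≥0 window) (x≤x⊔y (start window) 0#)) (lower≤upper window 0# horizon)))

      merged-feasible : Feasible merged
      merged-feasible j j∈K = 0 , ℕ.s≤s ℕ.z≤n ,
        subst (exec j ≤_) (sym (+-identityʳ _)) (exec≤processed (Equivalence.to K≈js j∈K))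

      -- The threshold 150 is where one long stretch stops being covered by the bound for two
      -- switch-ons: `opt e ≤ 200 + (51 - r)` amounts to `e ≤ 150`.
      opt≤energy : e ≤ fromℕ 150 → (S : Schedule K) → Feasible S → opt e ≤ energy unitPower S
      opt≤energy e≤150 S feasible = ≤-trans (bound (dichotomy ch S feasible (Equivalence.from K≈js))) (cost≤energy S e)
        where
        bound : fromℕ 200 + (horizon - r) ≤ cost e S ⊎
                (∃[ mI ] mI ∈ pieces S × start (proj₂ mI) ≤ r - fromℕ 1 × e ≤ stop (proj₂ mI)) →
                opt e ≤ cost e S
        bound (inj₁ two) = ≤-by (two ⊕ e≤150)
          (solve 3 (λ e r c → ♯ 100 :+ (e :- (r :- ♯ 1)) :+ (c :+ ♯ 150)
                      := c :+ (♯ 200 :+ (♯ 51 :- r) :+ e)) refl e r (cost e S))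
        bound (inj₂ ((m , I) , mI∈ , s≤ , e≤)) = ≤-trans
          (≤-by (s≤ ⊕ ≤-reflexive (sym (clamp-inside I (≤-trans s≤ (<⇒≤ (start<stop window))) e≤))
                    ⊕ ≤-reflexive (sym (switchCost-started I (≤-trans s≤ (<⇒≤ (start<stop window))))))
            (solve 5 (λ e r s c w → ♯ 100 :+ (e :- (r :- ♯ 1)) :+ (r :- ♯ 1 :+ c :+ w)
                        := w :+ (c :- s) :+ (s :+ e :+ ♯ 100)) refl e r (start I) (clamp I e) (switchCost e I)))
          (sum-∈ {f = costOf e} (costOf-nonNeg e) mI∈)

      merged-optimal : e ≤ fromℕ 150 → Optimal unitPower merged
      merged-optimal e≤150 = merged-feasible , λ S feasible →
        subst (_≤ energy unitPower S) (sym energy-merged) (opt≤energy e≤150 S feasible)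

-- The game between the adversary and an online algorithm.

module Adversary (R : Reals) where
  open Scheduling R
  open RealProperties R
  open IntegralProperties R
  open ScheduleProperties R
  open SingleProcessor R

  module Against (A : OnlineAlgorithm) (c : ℝ) (competitive : Competitive A c) (c≤ : fromℕ 100 * c ≤ fromℕ 206) where

    play : ∀ J → Schedule J
    play = run A unitPower

    play-feasible : ∀ J → Feasible (play J)
    play-feasible = feasible A unitPower

    Agree : ℝ → JobSet → JobSet → Set
    Agree u J J′ = ∀ {j} → arrival j ≤ u → j ∈ jobs J ⇔ j ∈ jobs J′

    Agree⇒SameDecisions : ∀ {u s J J′} → Agree u J J′ → 0# ≤ s → s ≤ u → SameDecisions s (play J) (play J′)
    Agree⇒SameDecisions {s = s} {J} {J′} agree 0≤s s≤u = online A unitPower J J′ s 0≤s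
      (mk⇔ (move J J′ λ a≤u → Equivalence.to (agree a≤u)) (move J′ J λ a≤u → Equivalence.from (agree a≤u)))
      where
      arrived? = λ j → arrival j ≤? s
      move : ∀ J J′ → (∀ {j} → arrival j ≤ _ → j ∈ jobs J → j ∈ jobs J′) →
             ∀ {j} → j ∈ jobs (arrivedBy s J) → j ∈ jobs (arrivedBy s J′)
      move J J′ J⊆J′ j∈ = let j∈J , a≤s = ∈-filter⁻ arrived? {xs = jobs J} j∈ in
        ∈-filter⁺ arrived? (J⊆J′ (≤-trans a≤s s≤u) j∈J) a≤s

    idle-transfer : ∀ {u s J J′} → Agree u J J′ → 0# ≤ s → s ≤ u → ¬ Active (play J) s → ¬ Active (play J′) s
    idle-transfer agree 0≤s s≤u idle active =
      idle (SameDecisions⇒Active⁻ (Agree⇒SameDecisions agree 0≤s s≤u) active)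

    active-transfer : ∀ {u s J J′} → Agree u J J′ → 0# ≤ s → s ≤ u → Active (play J) s → Active (play J′) s
    active-transfer agree 0≤s s≤u = SameDecisions⇒Active (Agree⇒SameDecisions agree 0≤s s≤u)

    flexOnly : JobSet
    flexOnly = record { jobs = flex ∷ [] ; unique = [] ∷ [] ; wellFormed = flex-wellFormed ∷ [] }

    module Game (r : ℝ) (1≤r : fromℕ 1 ≤ r) (r<horizon : r < horizon) where
      open Chains r 1≤r r<horizon

      Extends : JobSet → List Job → ℝ → Set
      Extends J js e = ∀ {j} → arrival j ≤ e → j ∈ jobs J ⇔ j ∈ js

      -- Quantifying over all extensions `J` makes the bound independent of later releases, so it
      -- can be carried from one round to the next.
      Spends : ∀ {js e} → Chain js e → ℝ → Set
      Spends {js} {e} _ a = ∀ J → Extends J js e → a ≤ cost e (play J)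

      0≤end : ∀ {js e} → Chain js e → 0# ≤ e
      0≤end ch = ≤-trans (<⇒≤ 0<horizon) (horizon≤end ch)

      opt-nonNeg : ∀ {js e} → Chain js e → 0# ≤ opt e
      opt-nonNeg {e = e} ch = ≤-by (fromℕ-nonNeg 100 ⊕ r-1≤r ⊕ <⇒≤ r<horizon ⊕ horizon≤end ch)
        (solve 3 (λ e r h → ♯ 0 :+ (♯ 100 :+ r :+ h :+ e) := ♯ 100 :+ (e :- (r :- ♯ 1)) :+ (♯ 0 :+ (r :- ♯ 1) :+ r :+ h))
          refl e r horizon)

      -- Nothing arrives after `e`, so the optimum is frozen at `opt e` for all later `t` while the
      -- spending of the algorithm may still grow.
      budget : ∀ {js e} (ch : Chain js e) → e ≤ fromℕ 150 → ∀ {t} → e ≤ t →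
               fromℕ 100 * cost t (play (jobSet ch)) ≤ fromℕ 206 * opt e
      budget {js} {e} ch e≤150 {t} e≤t = ≤-trans (100 ⊗ ≤-trans (cost≤energyUpTo (play J) t)
        (subst (λ E → energyUpTo unitPower t (play J) ≤ c * E) energy-merged
          (competitive unitPower J t (≤-trans (0≤end ch) e≤t) merged (merged-optimal e≤150))))
        (subst₂ _≤_ (solve 3 (λ o w c → o :* (w :* c) := w :* (c :* o)) refl (opt e) (fromℕ 100) c) (*-comm (opt e) (fromℕ 206))
          (*-monoˡ-≤ (opt e) (opt-nonNeg ch) c≤))
        where
        J = jobSet ch
        K≈js : ∀ {j} → j ∈ jobs (arrivedBy t J) ⇔ j ∈ js
        K≈js = mk⇔ (λ j∈ → proj₁ (∈-filter⁻ (λ j → arrival j ≤? t) {xs = js} j∈))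
                   (λ j∈ → ∈-filter⁺ (λ j → arrival j ≤? t) j∈ (≤-trans (arrival≤end ch j∈) e≤t))
        open Merged ch (arrivedBy t J) K≈js

      firstIdle : ∀ {js e} (ch : Chain js e) → e ≤ fromℕ 150 →
                  ∃[ u ] e ≤ u × ActiveOn (play (jobSet ch)) e u × ¬ Active (play (jobSet ch)) u
      firstIdle {js} {e} ch e≤150 = u , e≤u , active , idle
        where
        S = play (jobSet ch)

        Reached : ℝ → Set
        Reached v = e ≤ v × ActiveOn S e v

        -- A crude bound: `v - e` is at most `cost v S`, hence at most 100 times it, hence within
        -- the budget.
        bounded : ∀ v → Reached v → v ≤ e + fromℕ 206 * opt e
        bounded v (e≤v , active) = ≤-by
          (cost-while-active S e≤v active ⊕ cost-nonNeg S e ⊕ 99 ⊗ cost-nonNeg S v ⊕ budget ch e≤150 e≤v)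
          (solve 5 (λ v e o ce cv → v :+ (cv :+ ce :+ ♯ 99 :* cv :+ o)
              := e :+ o :+ (ce :+ (v :- e) :+ ♯ 0 :+ ♯ 99 :* ♯ 0 :+ ♯ 100 :* cv)) refl
            v e (fromℕ 206 * opt e) (cost e S) (cost v S))

        sup : ∃[ u ] UpperBound Reached u × (∀ v → UpperBound Reached v → u ≤ v)
        sup = complete Reached (e , ≤-refl , λ t e≤t t<e → contradiction e≤t (<⇒≱ t<e)) (_ , bounded)

        u = proj₁ sup

        e≤u : e ≤ u
        e≤u = proj₁ (proj₂ sup) e (≤-refl , λ t e≤t t<e → contradiction e≤t (<⇒≱ t<e))

        active : ActiveOn S e u
        active t e≤t t<u = decidable-stable (active? S t) λ idle → <⇒≱ t<u
          (proj₂ (proj₂ sup) t λ v (_ , act) → ≮⇒≥ λ t<v → idle (act t e≤t t<v))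

        idle : ¬ Active S u
        -- Intervals are half-open, so a piece that is on at `u` remains on for a while and would
        -- push the supremum further.
        idle act = let (m , I) , mI∈ , s≤u , u<f = find act in <⇒≱ u<f (proj₁ (proj₂ sup) (stop I)
          (≤-trans e≤u (<⇒≤ u<f) , λ t e≤t t<f → case u ≤? t of λ
            { (yes u≤t) → lose mI∈ (≤-trans s≤u u≤t , t<f)
            ; (no  u≰t) → active t e≤t (≰⇒> u≰t) }))

      -- The adversary waits until the algorithm is switched off and then
      -- releases an urgent job.
      advance : ∀ {js e a s} (ch : Chain js e) → e ≤ fromℕ 150 → Spends ch a →
                fromℕ 206 * opt e ≤ fromℕ 100 * a + s →
                ∃[ u ] e ≤ u × fromℕ 100 * (u - e) ≤ s ×
                ∃[ js′ ] Σ[ ch′ ∈ Chain js′ (u + fromℕ 1 + fromℕ 1) ] Spends ch′ (a + (u - e) + fromℕ 100)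
      advance {js} {e} {a} {s} ch e≤150 spends slack with firstIdle ch e≤150
      ... | u , e≤u , active , idle = u , e≤u , wait , _ , strike ch e<t , spends′
        where
        J = jobSet ch
        -- The release comes strictly after `u`, so the decision to be off at `u` itself is the same
        -- whether or not the job follows.
        t = u + fromℕ 1

        u<t : u < t
        u<t = x<x+y (fromℕ-pos 0)

        e<t : e < t
        e<t = ≤-<-trans e≤u u<t

        0≤e = 0≤end ch

        -- By time `u` at least `a + (u - e)` is spent, and the budget exceeds `100 * a` by at most
        -- `s`.
        wait : fromℕ 100 * (u - e) ≤ s
        wait = ≤-by (100 ⊗ (spends J (λ _ → mk⇔ id id)) ⊕ 100 ⊗ cost-while-active (play J) e≤u active
                     ⊕ budget ch e≤150 e≤u ⊕ slack)
          (solve 7 (λ a s u e o ce cu → ♯ 100 :* (u :- e) :+ (♯ 100 :* ce :+ ♯ 100 :* cu :+ o :+ (♯ 100 :* a :+ s))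
              := s :+ (♯ 100 :* a :+ ♯ 100 :* (ce :+ (u :- e)) :+ ♯ 100 :* cu :+ o)) refl
            a s u e (fromℕ 206 * opt e) (cost e (play J)) (cost u (play J)))

        spends′ : Spends (strike ch e<t) (a + (u - e) + fromℕ 100)
        -- Three instalments: `a` up to `e`, then `u - e` for staying on, then 100 for the switch-on
        -- that the urgent job forces.
        spends′ J′ extends = ≤-trans
          (spends J′ extends-before ⊕ ≤-refl ⊕ ≤-refl)
          (≤-trans (cost-while-active (play J′) e≤u active′ ⊕ ≤-refl)
            (cost-after-idle (play J′) (play-feasible J′) idle′ u<t
              (Equivalence.from (extends (<⇒≤ (x<x+y (fromℕ-pos 0)))) (here refl)) (0<y-x (x<x+y (fromℕ-pos 0)))
              (≤-trans (<⇒≤ u<t) (<⇒≤ (x<x+y (fromℕ-pos 0))))))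
          where
          before-strike : ∀ {j} → arrival j ≤ u → j ∈ jobs J′ ⇔ j ∈ js
          before-strike {j} a≤u = mk⇔
            (λ j∈J′ → drop (Equivalence.to (extends a≤end) j∈J′))
            (λ j∈js → Equivalence.from (extends a≤end) (there j∈js))
            where
            a≤end = ≤-trans a≤u (≤-trans (<⇒≤ u<t) (<⇒≤ (x<x+y (fromℕ-pos 0))))
            drop : j ∈ urgent t (t + fromℕ 1) ∷ js → j ∈ js
            drop (here refl) = contradiction a≤u (<⇒≱ u<t)
            drop (there j∈)  = j∈

          extends-before : Extends J′ js e
          extends-before a≤e = before-strike (≤-trans a≤e e≤u)

          agree : Agree u J J′
          agree a≤u = mk⇔ (Equivalence.from (before-strike a≤u)) (Equivalence.to (before-strike a≤u))

          active′ : ActiveOn (play J′) e u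
          active′ t e≤t t<u = active-transfer {J = J} {J′} agree (≤-trans 0≤e e≤t) (<⇒≤ t<u) (active t e≤t t<u)

          idle′ : ¬ Active (play J′) u
          idle′ = idle-transfer {J = J} {J′} agree (≤-trans 0≤e e≤u) ≤-refl idle

      -- Waiting for z and then forcing a switch-on adds 206 (z + 2) to 206 · opt and
      -- 100 (z + 100) to 100 · spent, so the slack changes by 106 z − 9588, and
      -- 6112 − 9588 = − 3476.
      module Endgame {a : ℝ} (slack : fromℕ 206 * opt horizon ≤ fromℕ 100 * a + fromℕ 6112)
                     {u₁ : ℝ} (wait₁ : fromℕ 100 * (u₁ - horizon) ≤ fromℕ 6112) where

        e₁ a₁ s₁ : ℝ
        e₁ = u₁ + fromℕ 1 + fromℕ 1
        a₁ = a + (u₁ - horizon) + fromℕ 100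
        s₁ = fromℕ 106 * (u₁ - horizon) - fromℕ 3476

        -- 6112 / 100, rounded up.
        z₁≤62 : u₁ - horizon ≤ fromℕ 62
        z₁≤62 = ⊗-cancel 99 (≤-by (wait₁ ⊕ fromℕ-nonNeg 88)
          (solve 1 (λ z → ♯ 100 :* z :+ (♯ 6112 :+ ♯ 88) := ♯ 100 :* ♯ 62 :+ (♯ 100 :* z :+ ♯ 0)) refl (u₁ - horizon)))

        e₁≤150 : e₁ ≤ fromℕ 150
        e₁≤150 = ≤-by (z₁≤62 ⊕ fromℕ-nonNeg 35)
          (solve 1 (λ u → u :+ ♯ 1 :+ ♯ 1 :+ (♯ 62 :+ ♯ 35) := ♯ 150 :+ (u :- ♯ 51 :+ ♯ 0)) refl u₁)

        slack₁ : fromℕ 206 * opt e₁ ≤ fromℕ 100 * a₁ + s₁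
        slack₁ = ≤-by slack
          (solve 3 (λ a u r → ♯ 206 :* (♯ 100 :+ (u :+ ♯ 1 :+ ♯ 1 :- (r :- ♯ 1))) :+ (♯ 100 :* a :+ ♯ 6112)
              := ♯ 100 :* (a :+ (u :- ♯ 51) :+ ♯ 100) :+ (♯ 106 :* (u :- ♯ 51) :- ♯ 3476)
                 :+ ♯ 206 :* (♯ 100 :+ (♯ 51 :- (r :- ♯ 1)))) refl a u₁ r)

        module _ {u₂ : ℝ} (wait₂ : fromℕ 100 * (u₂ - e₁) ≤ s₁) where

          e₂ a₂ : ℝ
          e₂ = u₂ + fromℕ 1 + fromℕ 1
          a₂ = a₁ + (u₂ - e₁) + fromℕ 100

          -- 106 · 62 - 3476 = 3096; again divided by 100 and rounded up.
          z₂≤31 : u₂ - e₁ ≤ fromℕ 31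
          z₂≤31 = ⊗-cancel 99 (≤-by (wait₂ ⊕ 106 ⊗ z₁≤62 ⊕ fromℕ-nonNeg 4)
            (solve 2 (λ z w → ♯ 100 :* z :+ (♯ 106 :* w :- ♯ 3476 :+ ♯ 106 :* ♯ 62 :+ ♯ 4)
                := ♯ 100 :* ♯ 31 :+ (♯ 100 :* z :+ ♯ 106 :* w :+ ♯ 0)) refl (u₂ - e₁) (u₁ - horizon)))

          e₂≤150 : e₂ ≤ fromℕ 150
          e₂≤150 = ≤-by (z₁≤62 ⊕ z₂≤31 ⊕ fromℕ-nonNeg 2)
            (solve 2 (λ u v → v :+ ♯ 1 :+ ♯ 1 :+ (♯ 62 :+ ♯ 31 :+ ♯ 2)
                := ♯ 150 :+ (u :- ♯ 51 :+ (v :- (u :+ ♯ 1 :+ ♯ 1)) :+ ♯ 0)) refl u₁ u₂)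

          overspent : ∀ {js} (ch : Chain js e₂) → Spends ch a₂ → ⊥
          -- The final slack is at most 3096 + 106 · 31 - 9588 = -3206, although the budget makes it
          -- nonnegative.
          overspent ch spends = <⇒≱ (fromℕ-pos 3205) (≤-by
            (100 ⊗ spends (jobSet ch) (λ _ → mk⇔ id id) ⊕ budget ch e₂≤150 ≤-refl ⊕ slack₁
               ⊕ 106 ⊗ z₂≤31 ⊕ 106 ⊗ z₁≤62)
            (solve 5 (λ a u v r k → ♯ 3206 :+ (♯ 100 :* k
                   :+ ♯ 206 :* (♯ 100 :+ (v :+ ♯ 1 :+ ♯ 1 :- (r :- ♯ 1)))
                   :+ (♯ 100 :* (a :+ (u :- ♯ 51) :+ ♯ 100) :+ (♯ 106 :* (u :- ♯ 51) :- ♯ 3476))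
                   :+ ♯ 106 :* ♯ 31 :+ ♯ 106 :* ♯ 62)
                := ♯ 0 :+ (♯ 100 :* (a :+ (u :- ♯ 51) :+ ♯ 100 :+ (v :- (u :+ ♯ 1 :+ ♯ 1)) :+ ♯ 100)
                   :+ ♯ 100 :* k
                   :+ ♯ 206 :* (♯ 100 :+ (u :+ ♯ 1 :+ ♯ 1 :- (r :- ♯ 1)))
                   :+ ♯ 106 :* (v :- (u :+ ♯ 1 :+ ♯ 1)) :+ ♯ 106 :* (u :- ♯ 51))) refl
              a u₁ u₂ r (cost e₂ (play (jobSet ch)))))

      horizon≤150 : horizon ≤ fromℕ 150
      horizon≤150 = ≤-by (fromℕ-nonNeg 99) (solve 0 (♯ 51 :+ ♯ 99 := ♯ 150 :+ ♯ 0) refl)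

      defeat : ∀ {a} → Spends base a → fromℕ 206 * opt horizon ≤ fromℕ 100 * a + fromℕ 6112 → ⊥
      defeat spends slack =
        let _ , _ , wait₁ , _ , ch₁ , spends₁ = advance base horizon≤150 spends slack
            _ , _ , wait₂ , _ , ch₂ , spends₂ = advance ch₁ (e₁≤150 slack wait₁) spends₁ (slack₁ slack wait₁)
        in overspent slack wait₁ wait₂ ch₂ spends₂
        where open Endgame

      flexOnly-agree : ∀ {u} → u < r → ∀ {J} → Extends J (tight ∷ flex ∷ []) horizon → Agree u flexOnly J
      flexOnly-agree u<r extends {j} a≤u = mk⇔
        (λ { (here refl) → Equivalence.from (extends a≤h) (there (here refl)) })
        (λ j∈J → keep (Equivalence.to (extends a≤h) j∈J))
        where
        a≤h = ≤-trans a≤u (<⇒≤ (≤-<-trans (<⇒≤ u<r) r<horizon))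
        keep : j ∈ tight ∷ flex ∷ [] → j ∈ flex ∷ []
        keep (here refl) = contradiction a≤u (<⇒≱ u<r)
        keep (there j∈)  = j∈

      base⊆ : ∀ {J} → Extends J (tight ∷ flex ∷ []) horizon → ∀ {j} → j ∈ tight ∷ flex ∷ [] → j ∈ jobs J
      base⊆ extends j∈ = Equivalence.from (extends (arrival≤end base j∈)) j∈

      -- With `r` at most 1, a sole interval has to start by `r - 1`, that is at time 0, where the
      -- algorithm is off.
      spends-lazy : r ≤ fromℕ 1 → ¬ Active (play flexOnly) 0# → Spends base (fromℕ 200 + (horizon - r))
      spends-lazy r≤1 idle J extends = [ id , (λ ((m , I) , mI∈ , s≤ , h≤f) → contradiction
          (lose mI∈ (≤-trans s≤ (≤-by r≤1 (solve 1 (λ r → r :- ♯ 1 :+ ♯ 1 := ♯ 0 :+ r) refl r)) , <-≤-trans 0<horizon h≤f))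
          (idle-transfer {J = flexOnly} {J} (flexOnly-agree 0<r {J} extends) ≤-refl ≤-refl idle)) ]′
        (dichotomy base (play J) (play-feasible J) (base⊆ {J} extends))

      spends-interrupted : ∀ {u} → Active (play flexOnly) 0# → 0# ≤ u → u < r → ¬ Active (play flexOnly) u →
                           Spends base (fromℕ 200)
      spends-interrupted {u} active 0≤u u<r idle J extends = ≤-trans
        (≤-by (cost-active (play J) (active-transfer {J = flexOnly} {J} agree ≤-refl 0≤u active)
                ⊕ cost-mono (play J) 0≤u)
          (solve 2 (λ x y → ♯ 200 :+ (x :+ y) := y :+ ♯ 100 :+ (♯ 100 :+ x)) refl (cost 0# (play J)) (cost u (play J))))
        (cost-after-idle (play J) (play-feasible J) (idle-transfer {J = flexOnly} {J} agree 0≤u ≤-refl idle) u<r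
          (base⊆ {J} extends (here refl)) (0<y-x r<horizon) (<⇒≤ (≤-<-trans (<⇒≤ u<r) r<horizon)))
        where
        agree = flexOnly-agree u<r {J} extends

      spends-eager : ActiveOn (play flexOnly) 0# r → Spends base (fromℕ 100 + r)
      spends-eager active J extends = ≤-trans
        (≤-by (cost-active (play J) (active′ 0# ≤-refl 0<r) ⊕ cost-while-active (play J) 0≤r active′)
          (solve 3 (λ r x y → ♯ 100 :+ r :+ (x :+ y) := y :+ (♯ 100 :+ (x :+ (r :- ♯ 0)))) refl r
            (cost 0# (play J)) (cost r (play J))))
        (cost-mono (play J) (<⇒≤ r<horizon))
        where
        active′ : ActiveOn (play J) 0# r
        active′ t 0≤t t<r = active-transfer {J = flexOnly} {J} (flexOnly-agree t<r {J} extends) 0≤t ≤-refl (active t 0≤t t<r)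

    1<51 : fromℕ 1 < horizon
    1<51 = <-by (fromℕ-pos 49) (solve 0 (♯ 1 :+ ♯ 50 := ♯ 51 :+ ♯ 0) refl)

    50<51 : fromℕ 50 < horizon
    50<51 = <-by (fromℕ-pos 0) (solve 0 (♯ 50 :+ ♯ 1 := ♯ 51 :+ ♯ 0) refl)

    1≤50 : fromℕ 1 ≤ fromℕ 50
    1≤50 = ≤-by (fromℕ-nonNeg 49) (solve 0 (♯ 1 :+ ♯ 49 := ♯ 50 :+ ♯ 0) refl)

    module Lazy  = Game (fromℕ 1) ≤-refl 1<51
    module Eager = Game (fromℕ 50) 1≤50 50<51

    absurd : ⊥
    absurd with active? (play flexOnly) 0#
    -- 206 · 151 - 100 · 250 = 6106, the largest of the three starting slacks.
    ... | no idle = Lazy.defeat (Lazy.spends-lazy ≤-refl idle) (≤-by (fromℕ-nonNeg 6)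
            (solve 0 (♯ 206 :* (♯ 100 :+ (♯ 51 :- (♯ 1 :- ♯ 1))) :+ ♯ 6 := ♯ 100 :* (♯ 200 :+ (♯ 51 :- ♯ 1)) :+ ♯ 6112 :+ ♯ 0) refl))
    -- Activity is decidable at each instant only. An idle instant is refuted by a game of its own,
    -- with slack 206 · 102 - 100 · 200 = 1012; hence the algorithm is on throughout, and the outer
    -- game starts from 206 · 102 - 100 · 150 = 6012.
    ... | yes active = Eager.defeat (Eager.spends-eager λ t 0≤t t<50 → decidable-stable (active? (play flexOnly) t) λ idle →
            Eager.defeat (Eager.spends-interrupted active 0≤t t<50 idle) (≤-by (fromℕ-nonNeg 5100)
              (solve 0 (♯ 206 :* (♯ 100 :+ (♯ 51 :- (♯ 50 :- ♯ 1))) :+ ♯ 5100 := ♯ 100 :* ♯ 200 :+ ♯ 6112 :+ ♯ 0) refl)))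
            (≤-by (fromℕ-nonNeg 100)
              (solve 0 (♯ 206 :* (♯ 100 :+ (♯ 51 :- (♯ 50 :- ♯ 1))) :+ ♯ 100 := ♯ 100 :* (♯ 100 :+ ♯ 50) :+ ♯ 6112 :+ ♯ 0) refl))

theorem4 : (R : Reals) →
    let open Scheduling R in
    (A : OnlineAlgorithm) (c : ℝ) →
    Competitive A c →
    fromℕ 206 * fromℕ 100 ⁻¹ ≤ c
theorem4 R A c competitive = ≮⇒≥ λ c<2⋅06 →
  Adversary.Against.absurd R A c competitive (100c≤206 (<⇒≤ c<2⋅06))
  where
  open Reals R
  open RealProperties R
  100c≤206 : c ≤ fromℕ 206 * fromℕ 100 ⁻¹ → fromℕ 100 * c ≤ fromℕ 206
  100c≤206 c≤ = ≤-by (100 ⊗ c≤ ⊕ ≤-reflexive (trans (cong (fromℕ 206 *_) (*-inverseʳ _ (pos⇒≢0 (fromℕ-pos 99)))) (*-identityʳ _)))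
    (solve 4 (λ h i k c → h :* c :+ (h :* (k :* i) :+ k) := k :+ (h :* c :+ k :* (h :* i))) refl
      (fromℕ 100) (fromℕ 100 ⁻¹) (fromℕ 206) c)
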